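{- Let $L=(\mathcal L,\mathrm{Act})$ be a signature with deterministic assignments. The first-order modal $\mu$-calculus and first-order game logic are equi-expressive over any $L$-assignment structure $\mathfrak A$: (1) $\mathfrak A[\![\varphi]\!]_{\mathrm{GL}}=\mathfrak A[\![\varphi^\sharp]\!]_{\mu}$ for any $\mathrm{G}L$-formula $\varphi$; (2) $\mathfrak A[\![\psi]\!]_{\mu}=\mathfrak A[\![\psi^\flat]\!]_{\mathrm{GL}}$ for any $L\mu$-formula $\psi$.
   Context: A signature $L=(\mathcal L,\mathrm{Act})$ is a first-order signature $\mathcal L$ together with a set $\mathrm{Act}$ of transition symbols. Fix an infinite set $\mathcal X$ of object variables and an infinite set $\mathcal V$ of propositional variables; each $X\in\mathcal V$ has a fresh complement $\overline X\notin\mathcal V$, $\overline{\overline X}=X$, $\overline{\mathcal V}=\mathcal V\cup\{\overline X:X\in\mathcal V\}$. A literal is an atomic first-order $\mathcal L$-formula (with equality) over $\mathcal X$ or the negation of one. $L$-structure $\mathfrak A$: an $\mathcal L$-structure with domain $|\mathfrak A|$, with a relation $\mathfrak A[\![a]\!]\subseteq\mathcal S\times\mathcal S$ for each $a\in\mathrm{Act}$, where $\mathcal S$ is the set of states $\omega:\mathcal X\to|\mathfrak A|$. $\omega[x\mapsto e]$ is $\omega$ with the value at $x$ changed to $e$. A valuation is a map $\Omega:\mathcal V\to\mathcal P(\mathcal S)$, extended by $\Omega(\overline X)=\mathcal S\setminus\Omega(X)$; $\Omega[X\mapsto E]$ is the valuation which gives $X\in\overline{\mathcal V}$ the value $E$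 (and $\overline X$ the value $\mathcal S\setminus E$) and otherwise agrees with $\Omega$. $L\mu[\mathcal V]$-formulas: $\varphi::=p\mid X\mid\varphi\lor\varphi\mid\varphi\land\varphi\mid\langle a\rangle\varphi\mid[a]\varphi\mid\mu X.\psi\mid\nu X.\psi$ with $p$ a literal, $X\in\overline{\mathcal V}$, $a\in\mathrm{Act}$, $\psi$ not mentioning $\overline X$. $L\mu$-formulas are those without free propositional variables. Semantics: $\Omega[\![p]\!]_\mu$ is the set of states satisfying $p$; $\Omega[\![X]\!]_\mu=\Omega(X)$; $\lor,\land$ are $\cup,\cap$; $\Omega[\![\langle a\rangle\varphi]\!]_\mu=\{\omega:\exists(\omega,\nu)\in\mathfrak A[\![a]\!],\ \nu\in\Omega[\![\varphi]\!]_\mu\}$; $\Omega[\![[a]\varphi]\!]_\mu=\{\omega:\forall(\omega,\nu)\in\mathfrak A[\![a]\!],\ \nu\in\Omega[\![\varphi]\!]_\mu\}$; $\Omega[\![\mu X.\varphi]\!]_\mu=\bigcap\{D\subseteq\mathcal S:\Omega[X\mapsto D][\![\varphi]\!]_\mu\subseteq D\}$; $\Omega[\![\nu X.\varphi]\!]_\mu=\bigcup\{D\subseteq\mathcal S:D\subseteq\Omega[X\mapsto D][\![\varphi]\!]_\mu\}$. For $L\mu$-formulas this is independent of $\Omega$ and written $\mathfrak A[\![\varphi]\!]_\mu$. Syntactic negation $\overline\varphi$: $\overline p$ is $\neg p$, $\overline{(\overline X)}=X$, it exchanges $\lor/\land$ and $\langle a\rangle/[a]$, and $\overline{\mu X.\varphi}=\nu\overline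 X.\overline\varphi$, $\overline{\nu X.\varphi}=\mu\overline X.\overline\varphi$. $\mathrm{G}L[\mathcal V]$-formulas and games: $\varphi::=p\mid X\mid\neg\varphi\mid\varphi\lor\varphi\mid\langle\gamma\rangle\varphi$, $\gamma::=a\mid{?\varphi}\mid\gamma\cup\gamma\mid\gamma;\gamma\mid\gamma^*\mid\gamma^{d}$ ($p$ literal, $X\in\mathcal V$, $a\in\mathrm{Act}$; $\overline X$ is identified with $\neg X$). $\mathrm{G}L$-formulas are those without propositional variables. Semantics: literals, variables, $\neg,\lor$ as usual; $\Omega[\![\langle\gamma\rangle\varphi]\!]_{\mathrm{GL}}=\Omega[\![\gamma]\!](\Omega[\![\varphi]\!]_{\mathrm{GL}})$, where $\Omega[\![a]\!](D)=\{\omega:\exists(\omega,\nu)\in\mathfrak A[\![a]\!],\nu\in D\}$, $\Omega[\![?\varphi]\!](D)=\Omega[\![\varphi]\!]_{\mathrm{GL}}\cap D$, $\Omega[\![\gamma_1\cup\gamma_2]\!](D)=\Omega[\![\gamma_1]\!](D)\cup\Omega[\![\gamma_2]\!](D)$, $\Omega[\![\gamma_1;\gamma_2]\!](D)=\Omega[\![\gamma_1]\!](\Omega[\![\gamma_2]\!](D))$, $\Omega[\![\gamma^*]\!](D)=\bigcap\{Z\subseteq\mathcal S:D\cup\Omega[\![\gamma]\!](Z)\subseteq Z\}$, $\Omega[\![\gamma^d]\!](D)=\mathcal S\setminus\Omega[\![\gamma]\!](\mathcal S\setminus D)$. For $\mathrm{G}L$-formulas write $\mathfrak A[\![\varphi]\!]_{\mathrm{GL}}$.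 Abbreviations: $\gamma_1\cap\gamma_2=(\gamma_1^d\cup\gamma_2^d)^d$, $\gamma^\times=((\gamma^d)^*)^d$; $\top,\bot$ denote truth and falsity. $L$ has deterministic assignments if $\mathcal L$ contains distinct constant symbols $0,1$ and $(x:=\theta)\in\mathrm{Act}$ for every $x\in\mathcal X$ and $\mathcal L$-term $\theta$. An $L$-structure is an assignment structure if $0^{\mathfrak A}\ne1^{\mathfrak A}$ and $\mathfrak A[\![x:=\theta]\!]=\{(\omega,\omega[x\mapsto\omega[\![\theta]\!]]):\omega\in\mathcal S\}$. Translation $\sharp$: $p^\sharp=p$, $X^\sharp=X$, $(\neg\varphi)^\sharp=\overline{\varphi^\sharp}$, $(\varphi_1\lor\varphi_2)^\sharp=\varphi_1^\sharp\lor\varphi_2^\sharp$, $(\langle a\rangle\varphi)^\sharp=\langle a\rangle\varphi^\sharp$, $(\langle?\varphi_1\rangle\varphi_2)^\sharp=\varphi_1^\sharp\land\varphi_2^\sharp$, $(\langle\gamma_1\cup\gamma_2\rangle\varphi)^\sharp=(\langle\gamma_1\rangle\varphi)^\sharp\lor(\langle\gamma_2\rangle\varphi)^\sharp$, $(\langle\gamma_1;\gamma_2\rangle\varphi)^\sharp=(\langle\gamma_1\rangle\langle\gamma_2\rangle\varphi)^\sharp$, $(\langle\gamma^d\rangle\varphi)^\sharp=\overline{(\langle\gamma\rangle\neg\varphi)^\sharp}$, $(\langle\gamma^*\rangle\varphi)^\sharp=\mu X.(\varphi\lor\langle\gamma\rangle X)^\sharp$ with $X$ fresh. Translation $\flat$: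 by renaming bound propositional variables, formulas $\psi$ are taken so that every propositional variable is bound at most once, with object variables in a finite set $\mathcal X_0\subseteq\mathcal X$, propositional variables in a finite set $\mathcal V_0\subseteq\overline{\mathcal V}$ and transition symbols in a finite set $\Lambda\subseteq\mathrm{Act}$. It is assumed that $\mathcal L$ has constant symbols $\kappa_X$, $X\in\mathcal V_0$, interpreted by pairwise distinct elements, and that $c\in\mathcal X\setminus\mathcal X_0$ is a control variable independent of each $a\in\Lambda$, meaning: $(\omega,\nu)\in\mathfrak A[\![a]\!]$ implies $(\omega[c\mapsto b],\nu[c\mapsto b])\in\mathfrak A[\![a]\!]$ for all $b\in|\mathfrak A|$. For subformulas of an $L\mu$-formula define games $G(\cdot)$: $G(p)={?p};(?\bot)^d$; $G(X)=(c:=\kappa_X)$; $G(\varphi_1\lor\varphi_2)=G(\varphi_1)\cup G(\varphi_2)$; $G(\varphi_1\land\varphi_2)=G(\varphi_1)\cap G(\varphi_2)$; $G(\langle a\rangle\varphi)=a;G(\varphi)$; $G([a]\varphi)=a^d;G(\varphi)$; $G(\mu X.\varphi)=c:=\kappa_X;(?c=\kappa_X;G(\varphi))^*;?c\ne\kappa_X$; $G(\nu X.\varphi)=c:=\kappa_X;((?c=\kappa_X)^d;G(\varphi))^\times;(?c\ne\kappa_X)^d$. Then $\psi^\flat=\langle G(\psi)\rangle\top$. -}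

module Defs where

open import Axiom.ExcludedMiddle using (ExcludedMiddle)
open import Data.Bool using (Bool; true; not; if_then_else_) renaming (_∨_ to _or_; _∧_ to _and_)
open import Data.List using (List; []; _∷_; _++_)
open import Data.List.Membership.Propositional using (_∈_; _∉_)
open import Data.List.Membership.Propositional.Properties using (∈-++⁺ˡ; ∈-++⁺ʳ)
open import Data.List.Relation.Binary.Subset.Propositional using (_⊆_)
open import Data.List.Relation.Unary.Any using (here; there)
open import Data.List.Relation.Unary.Unique.Propositional using (Unique)
open import Data.Nat using (ℕ)
open import Data.Product using (∃; _×_; _,_; proj₁; proj₂)
open import Data.Unit using (⊤; tt)
open import Data.Vec using (Vec; []; _∷_)
open import Function using (_∘_; _⇔_)
open import Level using (0ℓ)
open import Relation.Binary.PropositionalEquality using (_≡_; _≢_; refl; sym; cong; cong₂; subst)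
open import Relation.Nullary using (¬_; does)

-- Infinite: every finite list omits some element.  A proof supplies a concrete
-- omitted element, hence also the choice of fresh variables used in _♯ below.
Infinite : Set → Set
Infinite A = (xs : List A) → ∃ λ x → x ∉ xs

-- Fun n and Rel n are the n-ary function and relation symbols; constants are Fun 0.
record Signature : Set₁ where
  field
    Fun : ℕ → Set
    Rel : ℕ → Set
    Act : Set

module Syntax (𝒳 𝒱 : Set) (L : Signature) where

  open Signature L

  data Term : Set where
    var : 𝒳 → Term
    fun : ∀ {n} → Fun n → Vec Term n → Term

  data Atom : Set where
    _≐_ : Term → Term → Atom
    rel : ∀ {n} → Rel n → Vec Term n → Atom

  data Literal : Set where
    +ˡ_ : Atom → Literal
    -ˡ_ : Atom → Literal

  ¬ˡ_ : Literal → Literal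
  ¬ˡ (+ˡ α) = -ˡ α
  ¬ˡ (-ˡ α) = +ˡ α

  const : Fun 0 → Term
  const k = fun k []

  mutual
    objVarsᵗ : Term → List 𝒳
    objVarsᵗ (var x)    = x ∷ []
    objVarsᵗ (fun f ts) = objVarsᵗˢ ts

    objVarsᵗˢ : ∀ {n} → Vec Term n → List 𝒳
    objVarsᵗˢ []       = []
    objVarsᵗˢ (t ∷ ts) = objVarsᵗ t ++ objVarsᵗˢ ts

  objVarsᵃ : Atom → List 𝒳
  objVarsᵃ (s ≐ t)    = objVarsᵗ s ++ objVarsᵗ t
  objVarsᵃ (rel r ts) = objVarsᵗˢ ts

  objVars : Literal → List 𝒳
  objVars (+ˡ α) = objVarsᵃ α
  objVars (-ˡ α) = objVarsᵃ α

  record DeterministicAssignments : Set where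
    field
      𝟎 𝟏         : Fun 0
      𝟎≢𝟏         : 𝟎 ≢ 𝟏
      _≔_         : 𝒳 → Term → Act
      ≔-injective : ∀ {x y θ η} → (x ≔ θ) ≡ (y ≔ η) → x ≡ y × θ ≡ η

  data 𝒱± : Set where
    pos neg : 𝒱 → 𝒱±

  _⁻ : 𝒱± → 𝒱±
  pos X ⁻ = neg X
  neg X ⁻ = pos X

  ∣_∣ : 𝒱± → 𝒱
  ∣ pos X ∣ = X
  ∣ neg X ∣ = X

  infix  4 _∌_
  infixr 6 _∨_
  infixr 7 _∧_
  infixr 8 ⟨_⟩_ [_]_

  -- φ ∌ Y : the formula φ does not mention Y (freely).  This is defined
  -- simultaneously with the formulas, since a fixpoint binder for X may only
  -- be put in front of a formula that does not mention the complement of X.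
  data Lμ : Set
  _∌_ : Lμ → 𝒱± → Set

  data Lμ where
    lit   : Literal → Lμ
    var   : 𝒱± → Lμ
    _∨_   : Lμ → Lμ → Lμ
    _∧_   : Lμ → Lμ → Lμ
    ⟨_⟩_  : Act → Lμ → Lμ
    [_]_  : Act → Lμ → Lμ
    μ     : (X : 𝒱±) (ψ : Lμ) → ψ ∌ X ⁻ → Lμ
    ν     : (X : 𝒱±) (ψ : Lμ) → ψ ∌ X ⁻ → Lμ

  lit p     ∌ Y = ⊤
  var X     ∌ Y = Y ≢ X
  (φ₁ ∨ φ₂) ∌ Y = φ₁ ∌ Y × φ₂ ∌ Y
  (φ₁ ∧ φ₂) ∌ Y = φ₁ ∌ Y × φ₂ ∌ Y
  (⟨ a ⟩ φ) ∌ Y = φ ∌ Y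
  ([ a ] φ) ∌ Y = φ ∌ Y
  μ X ψ _   ∌ Y = Y ≢ X → ψ ∌ Y
  ν X ψ _   ∌ Y = Y ≢ X → ψ ∌ Y

  IsLμ : Lμ → Set
  IsLμ φ = ∀ Y → φ ∌ Y

  private
    ⁻-injective : ∀ {X Y} → X ⁻ ≡ Y ⁻ → X ≡ Y
    ⁻-injective {pos X} {pos .X} refl = refl
    ⁻-injective {neg X} {neg .X} refl = refl

  infix 9 ∼_

  ∼_ : Lμ → Lμ
  ∼-∌ : ∀ φ Y → φ ∌ Y → ∼ φ ∌ Y ⁻

  ∼ lit p     = lit (¬ˡ p)
  ∼ var X     = var (X ⁻)
  ∼ (φ₁ ∨ φ₂) = ∼ φ₁ ∧ ∼ φ₂
  ∼ (φ₁ ∧ φ₂) = ∼ φ₁ ∨ ∼ φ₂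
  ∼ (⟨ a ⟩ φ) = [ a ] ∼ φ
  ∼ ([ a ] φ) = ⟨ a ⟩ ∼ φ
  ∼ μ X ψ h   = ν (X ⁻) (∼ ψ) (∼-∌ ψ (X ⁻) h)
  ∼ ν X ψ h   = μ (X ⁻) (∼ ψ) (∼-∌ ψ (X ⁻) h)

  ∼-∌ (lit p)     Y h         = tt
  ∼-∌ (var X)     Y h         = h ∘ ⁻-injective
  ∼-∌ (φ₁ ∨ φ₂)   Y (h₁ , h₂) = ∼-∌ φ₁ Y h₁ , ∼-∌ φ₂ Y h₂
  ∼-∌ (φ₁ ∧ φ₂)   Y (h₁ , h₂) = ∼-∌ φ₁ Y h₁ , ∼-∌ φ₂ Y h₂
  ∼-∌ (⟨ a ⟩ φ)   Y h         = ∼-∌ φ Y h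
  ∼-∌ ([ a ] φ)   Y h         = ∼-∌ φ Y h
  ∼-∌ (μ X ψ _)   Y h         = λ Y≢X → ∼-∌ ψ Y (h (Y≢X ∘ cong _⁻))
  ∼-∌ (ν X ψ _)   Y h         = λ Y≢X → ∼-∌ ψ Y (h (Y≢X ∘ cong _⁻))

  infix  9 ¬ᴳ_
  infix  9 ？_
  infixr 6 _∪ᴳ_ _∩ᴳ_
  infixr 7 _⨾_
  infix  10 _* _ᵈ _^×

  mutual
    data GL : Set where
      lit  : Literal → GL
      var  : 𝒱 → GL
      ¬ᴳ_  : GL → GL
      _∨_  : GL → GL → GL
      ⟨_⟩_ : Game → GL → GL

    data Game : Set where
      act  : Act → Game
      ？_   : GL → Game
      _∪ᴳ_ : Game → Game → Game
      _⨾_  : Game → Game → Game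
      _*   : Game → Game
      _ᵈ   : Game → Game

  _∩ᴳ_ : Game → Game → Game
  γ₁ ∩ᴳ γ₂ = (γ₁ ᵈ ∪ᴳ γ₂ ᵈ) ᵈ

  _^× : Game → Game
  γ ^× = ((γ ᵈ) *) ᵈ

  mutual
    propVars : GL → List 𝒱
    propVars (lit p)   = []
    propVars (var X)   = X ∷ []
    propVars (¬ᴳ φ)    = propVars φ
    propVars (φ₁ ∨ φ₂) = propVars φ₁ ++ propVars φ₂
    propVars (⟨ γ ⟩ φ) = propVarsᴳ γ ++ propVars φ

    propVarsᴳ : Game → List 𝒱
    propVarsᴳ (act a)    = []
    propVarsᴳ (？ φ)      = propVars φ
    propVarsᴳ (γ₁ ∪ᴳ γ₂) = propVarsᴳ γ₁ ++ propVarsᴳ γ₂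
    propVarsᴳ (γ₁ ⨾ γ₂)  = propVarsᴳ γ₁ ++ propVarsᴳ γ₂
    propVarsᴳ (γ *)      = propVarsᴳ γ
    propVarsᴳ (γ ᵈ)      = propVarsᴳ γ

  IsGL : GL → Set
  IsGL φ = propVars φ ≡ []

  -- The variables of a formula, free or bound, with their polarity forgotten.
  allVars : Lμ → List 𝒱
  allVars (lit p)   = []
  allVars (var X)   = ∣ X ∣ ∷ []
  allVars (φ₁ ∨ φ₂) = allVars φ₁ ++ allVars φ₂
  allVars (φ₁ ∧ φ₂) = allVars φ₁ ++ allVars φ₂
  allVars (⟨ a ⟩ φ) = allVars φ
  allVars ([ a ] φ) = allVars φ
  allVars (μ X ψ _) = ∣ X ∣ ∷ allVars ψ
  allVars (ν X ψ _) = ∣ X ∣ ∷ allVars ψ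

  allVars-∌ : ∀ φ Y → ∣ Y ∣ ∉ allVars φ → φ ∌ Y
  allVars-∌ (lit p)   Y h = tt
  allVars-∌ (var X)   Y h = λ { refl → h (here refl) }
  allVars-∌ (φ₁ ∨ φ₂) Y h = allVars-∌ φ₁ Y (h ∘ ∈-++⁺ˡ) , allVars-∌ φ₂ Y (h ∘ ∈-++⁺ʳ (allVars φ₁))
  allVars-∌ (φ₁ ∧ φ₂) Y h = allVars-∌ φ₁ Y (h ∘ ∈-++⁺ˡ) , allVars-∌ φ₂ Y (h ∘ ∈-++⁺ʳ (allVars φ₁))
  allVars-∌ (⟨ a ⟩ φ) Y h = allVars-∌ φ Y h
  allVars-∌ ([ a ] φ) Y h = allVars-∌ φ Y h
  allVars-∌ (μ X ψ _) Y h = λ _ → allVars-∌ ψ Y (h ∘ there)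
  allVars-∌ (ν X ψ _) Y h = λ _ → allVars-∌ ψ Y (h ∘ there)

  -- Renaming of bound propositional variables (with their polarity): the list
  -- records the pairs of corresponding binders in scope, innermost first.
  data _⊢_≈ᵛ_ : List (𝒱± × 𝒱±) → 𝒱± → 𝒱± → Set where
    free  : ∀ {X} → [] ⊢ X ≈ᵛ X
    bound : ∀ {Γ X Y} → ((X , Y) ∷ Γ) ⊢ X ≈ᵛ Y
    skip  : ∀ {Γ X Y X′ Y′} → X ≢ X′ → Y ≢ Y′ → Γ ⊢ X ≈ᵛ Y → ((X′ , Y′) ∷ Γ) ⊢ X ≈ᵛ Y

  data _⊢_≈α_ (Γ : List (𝒱± × 𝒱±)) : Lμ → Lμ → Set where
    lit : ∀ {p} → Γ ⊢ lit p ≈α lit p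
    var : ∀ {X Y} → Γ ⊢ X ≈ᵛ Y → Γ ⊢ var X ≈α var Y
    or  : ∀ {φ₁ φ₂ ψ₁ ψ₂} → Γ ⊢ φ₁ ≈α ψ₁ → Γ ⊢ φ₂ ≈α ψ₂ → Γ ⊢ φ₁ ∨ φ₂ ≈α (ψ₁ ∨ ψ₂)
    and : ∀ {φ₁ φ₂ ψ₁ ψ₂} → Γ ⊢ φ₁ ≈α ψ₁ → Γ ⊢ φ₂ ≈α ψ₂ → Γ ⊢ φ₁ ∧ φ₂ ≈α (ψ₁ ∧ ψ₂)
    dia : ∀ {a φ ψ} → Γ ⊢ φ ≈α ψ → Γ ⊢ ⟨ a ⟩ φ ≈α (⟨ a ⟩ ψ)
    box : ∀ {a φ ψ} → Γ ⊢ φ ≈α ψ → Γ ⊢ [ a ] φ ≈α ([ a ] ψ)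
    mu  : ∀ {X Y φ ψ h k} → ((X , Y) ∷ Γ) ⊢ φ ≈α ψ → Γ ⊢ μ X φ h ≈α μ Y ψ k
    nu  : ∀ {X Y φ ψ h k} → ((X , Y) ∷ Γ) ⊢ φ ≈α ψ → Γ ⊢ ν X φ h ≈α ν Y ψ k

  infix 4 _≈α_
  _≈α_ : Lμ → Lμ → Set
  φ ≈α ψ = [] ⊢ φ ≈α ψ

  binders : Lμ → List 𝒱±
  binders (lit p)   = []
  binders (var X)   = []
  binders (φ₁ ∨ φ₂) = binders φ₁ ++ binders φ₂
  binders (φ₁ ∧ φ₂) = binders φ₁ ++ binders φ₂
  binders (⟨ a ⟩ φ) = binders φ
  binders ([ a ] φ) = binders φ
  binders (μ X ψ _) = X ∷ binders ψ
  binders (ν X ψ _) = X ∷ binders ψ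

  -- A variable and its complement count as different binders.
  BoundAtMostOnce : Lμ → Set
  BoundAtMostOnce φ = Unique (binders φ)

  Over : List 𝒳 → List 𝒱± → List Act → Lμ → Set
  Over 𝒳₀ 𝒱₀ Λ (lit p)   = objVars p ⊆ 𝒳₀
  Over 𝒳₀ 𝒱₀ Λ (var X)   = X ∈ 𝒱₀
  Over 𝒳₀ 𝒱₀ Λ (φ₁ ∨ φ₂) = Over 𝒳₀ 𝒱₀ Λ φ₁ × Over 𝒳₀ 𝒱₀ Λ φ₂
  Over 𝒳₀ 𝒱₀ Λ (φ₁ ∧ φ₂) = Over 𝒳₀ 𝒱₀ Λ φ₁ × Over 𝒳₀ 𝒱₀ Λ φ₂
  Over 𝒳₀ 𝒱₀ Λ (⟨ a ⟩ φ) = a ∈ Λ × Over 𝒳₀ 𝒱₀ Λ φ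
  Over 𝒳₀ 𝒱₀ Λ ([ a ] φ) = a ∈ Λ × Over 𝒳₀ 𝒱₀ Λ φ
  Over 𝒳₀ 𝒱₀ Λ (μ X ψ _) = X ∈ 𝒱₀ × Over 𝒳₀ 𝒱₀ Λ ψ
  Over 𝒳₀ 𝒱₀ Λ (ν X ψ _) = X ∈ 𝒱₀ × Over 𝒳₀ 𝒱₀ Λ ψ

module Sharp (𝒳 𝒱 : Set) (L : Signature) (inf𝒱 : Infinite 𝒱) where

  open Syntax 𝒳 𝒱 L

  infix  9 _♯
  infixr 8 ⟪_⟫_

  -- ⟪ γ ⟫ ψ is the translation of ⟨ γ ⟩ φ given the translation ψ of φ.  This
  -- makes the recursion structural; the usual equations, which recur on larger
  -- formulas in the cases of ⨾, ᵈ and *, hold definitionally (see below).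
  _♯     : GL → Lμ
  ⟪_⟫_   : Game → Lμ → Lμ
  fresh  : Game → Lμ → 𝒱
  fresh∉ : ∀ γ ψ → fresh γ ψ ∉ propVarsᴳ γ ++ allVars ψ
  ♯-∌    : ∀ φ Y → ∣ Y ∣ ∉ propVars φ → φ ♯ ∌ Y
  ⟪⟫-∌   : ∀ γ ψ Y → ∣ Y ∣ ∉ propVarsᴳ γ → ψ ∌ Y → ⟪ γ ⟫ ψ ∌ Y
  body-∌ : ∀ γ ψ → (ψ ∨ ⟪ γ ⟫ var (pos (fresh γ ψ))) ∌ neg (fresh γ ψ)

  fresh  γ ψ = proj₁ (inf𝒱 (propVarsᴳ γ ++ allVars ψ))
  fresh∉ γ ψ = proj₂ (inf𝒱 (propVarsᴳ γ ++ allVars ψ))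

  lit p ♯     = lit p
  var X ♯     = var (pos X)
  (¬ᴳ φ) ♯    = ∼ (φ ♯)
  (φ₁ ∨ φ₂) ♯ = φ₁ ♯ ∨ φ₂ ♯
  (⟨ γ ⟩ φ) ♯ = ⟪ γ ⟫ (φ ♯)

  ⟪ act a ⟫    ψ = ⟨ a ⟩ ψ
  ⟪ ？ φ ⟫      ψ = φ ♯ ∧ ψ
  ⟪ γ₁ ∪ᴳ γ₂ ⟫ ψ = ⟪ γ₁ ⟫ ψ ∨ ⟪ γ₂ ⟫ ψ
  ⟪ γ₁ ⨾ γ₂ ⟫  ψ = ⟪ γ₁ ⟫ ⟪ γ₂ ⟫ ψ
  ⟪ γ * ⟫      ψ = μ (pos (fresh γ ψ)) (ψ ∨ ⟪ γ ⟫ var (pos (fresh γ ψ))) (body-∌ γ ψ)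
  ⟪ γ ᵈ ⟫      ψ = ∼ (⟪ γ ⟫ ∼ ψ)

  body-∌ γ ψ = allVars-∌ ψ (neg X) (fresh∉ γ ψ ∘ ∈-++⁺ʳ (propVarsᴳ γ))
             , ⟪⟫-∌ γ (var (pos X)) (neg X) (fresh∉ γ ψ ∘ ∈-++⁺ˡ) (λ ())
    where X = fresh γ ψ

  ♯-∌ (lit p)   Y h = tt
  ♯-∌ (var X)   Y h = λ { refl → h (here refl) }
  ♯-∌ (¬ᴳ φ) (pos Y) h = ∼-∌ (φ ♯) (neg Y) (♯-∌ φ (neg Y) h)
  ♯-∌ (¬ᴳ φ) (neg Y) h = ∼-∌ (φ ♯) (pos Y) (♯-∌ φ (pos Y) h)
  ♯-∌ (φ₁ ∨ φ₂) Y h = ♯-∌ φ₁ Y (h ∘ ∈-++⁺ˡ) , ♯-∌ φ₂ Y (h ∘ ∈-++⁺ʳ (propVars φ₁))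
  ♯-∌ (⟨ γ ⟩ φ) Y h = ⟪⟫-∌ γ (φ ♯) Y (h ∘ ∈-++⁺ˡ) (♯-∌ φ Y (h ∘ ∈-++⁺ʳ (propVarsᴳ γ)))

  ⟪⟫-∌ (act a)    ψ Y h k = k
  ⟪⟫-∌ (？ φ)      ψ Y h k = ♯-∌ φ Y h , k
  ⟪⟫-∌ (γ₁ ∪ᴳ γ₂) ψ Y h k = ⟪⟫-∌ γ₁ ψ Y (h ∘ ∈-++⁺ˡ) k , ⟪⟫-∌ γ₂ ψ Y (h ∘ ∈-++⁺ʳ (propVarsᴳ γ₁)) k
  ⟪⟫-∌ (γ₁ ⨾ γ₂)  ψ Y h k =
    ⟪⟫-∌ γ₁ (⟪ γ₂ ⟫ ψ) Y (h ∘ ∈-++⁺ˡ) (⟪⟫-∌ γ₂ ψ Y (h ∘ ∈-++⁺ʳ (propVarsᴳ γ₁)) k)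
  ⟪⟫-∌ (γ *)      ψ Y h k = λ Y≢X → k , ⟪⟫-∌ γ (var (pos (fresh γ ψ))) Y h Y≢X
  ⟪⟫-∌ (γ ᵈ)      ψ (pos Y) h k = ∼-∌ (⟪ γ ⟫ ∼ ψ) (neg Y) (⟪⟫-∌ γ (∼ ψ) (neg Y) h (∼-∌ ψ (pos Y) k))
  ⟪⟫-∌ (γ ᵈ)      ψ (neg Y) h k = ∼-∌ (⟪ γ ⟫ ∼ ψ) (pos Y) (⟪⟫-∌ γ (∼ ψ) (pos Y) h (∼-∌ ψ (neg Y) k))

  ♯-closed : ∀ φ → IsGL φ → IsLμ (φ ♯)
  ♯-closed φ h Y = ♯-∌ φ Y (subst (∣ Y ∣ ∉_) (sym h) (λ ()))

  private
    module _ (a : Signature.Act L) (γ γ₁ γ₂ : Game) (φ φ₁ : GL) where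
      _ : (⟨ act a ⟩ φ) ♯ ≡ ⟨ a ⟩ (φ ♯)
      _ = refl
      _ : (⟨ ？ φ₁ ⟩ φ) ♯ ≡ φ₁ ♯ ∧ φ ♯
      _ = refl
      _ : (⟨ γ₁ ∪ᴳ γ₂ ⟩ φ) ♯ ≡ (⟨ γ₁ ⟩ φ) ♯ ∨ (⟨ γ₂ ⟩ φ) ♯
      _ = refl
      _ : (⟨ γ₁ ⨾ γ₂ ⟩ φ) ♯ ≡ (⟨ γ₁ ⟩ ⟨ γ₂ ⟩ φ) ♯
      _ = refl
      _ : (⟨ γ ᵈ ⟩ φ) ♯ ≡ ∼ ((⟨ γ ⟩ (¬ᴳ φ)) ♯)
      _ = refl
      _ : let X = fresh γ (φ ♯) in (⟨ γ * ⟩ φ) ♯ ≡ μ (pos X) ((φ ∨ ⟨ γ ⟩ var X) ♯) (body-∌ γ (φ ♯))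
      _ = refl

module Flat (𝒳 𝒱 : Set) (L : Signature) (det : Syntax.DeterministicAssignments 𝒳 𝒱 L) where

  open Signature L
  open Syntax 𝒳 𝒱 L
  open DeterministicAssignments det

  ⊤ᴳ ⊥ᴳ : GL
  ⊤ᴳ = lit (+ˡ (const 𝟎 ≐ const 𝟎))
  ⊥ᴳ = lit (-ˡ (const 𝟎 ≐ const 𝟎))

  -- κ is total for convenience; ψ ♭ uses it only at variables occurring in ψ.
  module _ (κ : 𝒱± → Fun 0) (c : 𝒳) where

    private
      c:=κ : 𝒱± → Game
      c:=κ X = act (c ≔ const (κ X))

      c=κ c≠κ : 𝒱± → GL
      c=κ X = lit (+ˡ (var c ≐ const (κ X)))
      c≠κ X = lit (-ˡ (var c ≐ const (κ X)))

    G : Lμ → Game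
    G (lit p)   = ？ lit p ⨾ (？ ⊥ᴳ) ᵈ
    G (var X)   = c:=κ X
    G (φ₁ ∨ φ₂) = G φ₁ ∪ᴳ G φ₂
    G (φ₁ ∧ φ₂) = G φ₁ ∩ᴳ G φ₂
    G (⟨ a ⟩ φ) = act a ⨾ G φ
    G ([ a ] φ) = (act a) ᵈ ⨾ G φ
    G (μ X φ _) = c:=κ X ⨾ (？ c=κ X ⨾ G φ) * ⨾ ？ c≠κ X
    G (ν X φ _) = c:=κ X ⨾ ((？ c=κ X) ᵈ ⨾ G φ) ^× ⨾ (？ c≠κ X) ᵈ

    _♭ : Lμ → GL
    ψ ♭ = ⟨ G ψ ⟩ ⊤ᴳ

    private
      propVars-G : ∀ φ → propVarsᴳ (G φ) ≡ []
      propVars-G (lit p)   = refl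
      propVars-G (var X)   = refl
      propVars-G (φ₁ ∨ φ₂) = cong₂ _++_ (propVars-G φ₁) (propVars-G φ₂)
      propVars-G (φ₁ ∧ φ₂) = cong₂ _++_ (propVars-G φ₁) (propVars-G φ₂)
      propVars-G (⟨ a ⟩ φ) = propVars-G φ
      propVars-G ([ a ] φ) = propVars-G φ
      propVars-G (μ X φ _) = cong (_++ []) (propVars-G φ)
      propVars-G (ν X φ _) = cong (_++ []) (propVars-G φ)

    ♭-closed : ∀ ψ → IsGL (ψ ♭)
    ♭-closed ψ = cong (_++ []) (propVars-G ψ)

-- Subsets are characteristic functions.  Under excluded middle every predicate
-- determines one, and these power sets, unlike A → Set, stay in Set, so that
-- the impredicative definitions of least and greatest fixpoints make sense.
𝒫 : Set → Set
𝒫 A = A → Bool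

infix 4 _∈ˢ_ _⊆ˢ_
_∈ˢ_ : ∀ {A : Set} → A → 𝒫 A → Set
x ∈ˢ D = D x ≡ true

_⊆ˢ_ : ∀ {A : Set} → 𝒫 A → 𝒫 A → Set
D ⊆ˢ E = ∀ x → x ∈ˢ D → x ∈ˢ E

infixr 6 _∪_
infixr 7 _∩_
_∪_ _∩_ : ∀ {A : Set} → 𝒫 A → 𝒫 A → 𝒫 A
(D ∪ E) x = D x or E x
(D ∩ E) x = D x and E x

∁ : ∀ {A : Set} → 𝒫 A → 𝒫 A
∁ D x = not (D x)

record Structure (𝒳 : Set) (L : Signature) : Set₁ where
  open Signature L
  field
    Carrier : Set
    ⟦fun⟧   : ∀ {n} → Fun n → Vec Carrier n → Carrier
    ⟦rel⟧   : ∀ {n} → Rel n → 𝒫 (Vec Carrier n)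

  State : Set
  State = 𝒳 → Carrier

  field
    ⟦act⟧   : Act → 𝒫 (State × State)

  ⟦const⟧ : Fun 0 → Carrier
  ⟦const⟧ k = ⟦fun⟧ k []

module Semantics (em : ExcludedMiddle 0ℓ) (𝒳 𝒱 : Set) (L : Signature) (𝔄 : Structure 𝒳 L) where

  open Signature L
  open Syntax 𝒳 𝒱 L
  open Structure 𝔄

  compr : ∀ {A : Set} → (A → Set) → 𝒫 A
  compr P x = does (em {P x})

  ⋂ ⋃ : ∀ {A : Set} → (𝒫 A → Set) → 𝒫 A
  ⋂ P = compr λ x → ∀ D → P D → x ∈ˢ D
  ⋃ P = compr λ x → ∃ λ D → P D × x ∈ˢ D

  update : ∀ {A B : Set} → (A → B) → A → B → A → B
  update f x b y = if does (em {y ≡ x}) then b else f y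

  _[_↦_] : State → 𝒳 → Carrier → State
  _[_↦_] = update

  mutual
    _⟦_⟧ᵗ : State → Term → Carrier
    ω ⟦ var x ⟧ᵗ    = ω x
    ω ⟦ fun f ts ⟧ᵗ = ⟦fun⟧ f (ω ⟦ ts ⟧ᵗˢ)

    _⟦_⟧ᵗˢ : ∀ {n} → State → Vec Term n → Vec Carrier n
    ω ⟦ [] ⟧ᵗˢ     = []
    ω ⟦ t ∷ ts ⟧ᵗˢ = ω ⟦ t ⟧ᵗ ∷ ω ⟦ ts ⟧ᵗˢ

  _⊨ᵃ_ : State → Atom → Set
  ω ⊨ᵃ (s ≐ t)  = ω ⟦ s ⟧ᵗ ≡ ω ⟦ t ⟧ᵗ
  ω ⊨ᵃ rel r ts = ω ⟦ ts ⟧ᵗˢ ∈ˢ ⟦rel⟧ r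

  _⊨_ : State → Literal → Set
  ω ⊨ (+ˡ α) = ω ⊨ᵃ α
  ω ⊨ (-ˡ α) = ¬ (ω ⊨ᵃ α)

  ⟦lit⟧ : Literal → 𝒫 State
  ⟦lit⟧ p = compr (_⊨ p)

  ⟦⟨_⟩⟧ ⟦[_]⟧ : Act → 𝒫 State → 𝒫 State
  ⟦⟨ a ⟩⟧ D = compr λ ω → ∃ λ ω′ → (ω , ω′) ∈ˢ ⟦act⟧ a × ω′ ∈ˢ D
  ⟦[ a ]⟧ D = compr λ ω → ∀ ω′ → (ω , ω′) ∈ˢ ⟦act⟧ a → ω′ ∈ˢ D

  Valuation : Set
  Valuation = 𝒱 → 𝒫 State

  _⟨_⟩± : Valuation → 𝒱± → 𝒫 State
  Ω ⟨ pos X ⟩± = Ω X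
  Ω ⟨ neg X ⟩± = ∁ (Ω X)

  _[_↦_]ᵛ : Valuation → 𝒱± → 𝒫 State → Valuation
  Ω [ pos X ↦ E ]ᵛ = update Ω X E
  Ω [ neg X ↦ E ]ᵛ = update Ω X (∁ E)

  _⟦_⟧μ : Valuation → Lμ → 𝒫 State
  Ω ⟦ lit p ⟧μ   = ⟦lit⟧ p
  Ω ⟦ var X ⟧μ   = Ω ⟨ X ⟩±
  Ω ⟦ φ₁ ∨ φ₂ ⟧μ = Ω ⟦ φ₁ ⟧μ ∪ Ω ⟦ φ₂ ⟧μ
  Ω ⟦ φ₁ ∧ φ₂ ⟧μ = Ω ⟦ φ₁ ⟧μ ∩ Ω ⟦ φ₂ ⟧μ
  Ω ⟦ ⟨ a ⟩ φ ⟧μ = ⟦⟨ a ⟩⟧ (Ω ⟦ φ ⟧μ)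
  Ω ⟦ [ a ] φ ⟧μ = ⟦[ a ]⟧ (Ω ⟦ φ ⟧μ)
  Ω ⟦ μ X φ _ ⟧μ = ⋂ λ D → (Ω [ X ↦ D ]ᵛ) ⟦ φ ⟧μ ⊆ˢ D
  Ω ⟦ ν X φ _ ⟧μ = ⋃ λ D → D ⊆ˢ (Ω [ X ↦ D ]ᵛ) ⟦ φ ⟧μ

  mutual
    _⟦_⟧GL : Valuation → GL → 𝒫 State
    Ω ⟦ lit p ⟧GL   = ⟦lit⟧ p
    Ω ⟦ var X ⟧GL   = Ω X
    Ω ⟦ ¬ᴳ φ ⟧GL    = ∁ (Ω ⟦ φ ⟧GL)
    Ω ⟦ φ₁ ∨ φ₂ ⟧GL = Ω ⟦ φ₁ ⟧GL ∪ Ω ⟦ φ₂ ⟧GL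
    Ω ⟦ ⟨ γ ⟩ φ ⟧GL = (Ω ⟦ γ ⟧ᴳ) (Ω ⟦ φ ⟧GL)

    _⟦_⟧ᴳ : Valuation → Game → 𝒫 State → 𝒫 State
    (Ω ⟦ act a ⟧ᴳ)    D = ⟦⟨ a ⟩⟧ D
    (Ω ⟦ ？ φ ⟧ᴳ)      D = Ω ⟦ φ ⟧GL ∩ D
    (Ω ⟦ γ₁ ∪ᴳ γ₂ ⟧ᴳ) D = (Ω ⟦ γ₁ ⟧ᴳ) D ∪ (Ω ⟦ γ₂ ⟧ᴳ) D
    (Ω ⟦ γ₁ ⨾ γ₂ ⟧ᴳ)  D = (Ω ⟦ γ₁ ⟧ᴳ) ((Ω ⟦ γ₂ ⟧ᴳ) D)
    (Ω ⟦ γ * ⟧ᴳ)      D = ⋂ λ Z → D ∪ (Ω ⟦ γ ⟧ᴳ) Z ⊆ˢ Z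
    (Ω ⟦ γ ᵈ ⟧ᴳ)      D = ∁ ((Ω ⟦ γ ⟧ᴳ) (∁ D))

  record IsAssignmentStructure (det : DeterministicAssignments) : Set where
    open DeterministicAssignments det
    field
      ⟦𝟎⟧≢⟦𝟏⟧ : ⟦const⟧ 𝟎 ≢ ⟦const⟧ 𝟏
      ⟦≔⟧     : ∀ x θ ω ω′ → (ω , ω′) ∈ˢ ⟦act⟧ (x ≔ θ) ⇔ ω′ ≡ ω [ x ↦ ω ⟦ θ ⟧ᵗ ]

  Independent : 𝒳 → Act → Set
  Independent c a =
    ∀ ω ω′ → (ω , ω′) ∈ˢ ⟦act⟧ a → ∀ b → (ω [ c ↦ b ] , ω′ [ c ↦ b ]) ∈ˢ ⟦act⟧ a

{-# OPTIONS --safe #-}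
module Submission where

open import Algebra.Lattice.Properties.BooleanAlgebra using (deMorgan₁; deMorgan₂)
open import Axiom.ExcludedMiddle using (ExcludedMiddle)
open import Axiom.Extensionality.Propositional using (Extensionality)
open import Data.Bool using (true; false; not; if_then_else_) renaming (_∨_ to _||_; _∧_ to _&&_)
open import Data.Bool.Properties
  using (⇔→≡; not-involutive; ∨-zeroʳ; ∨-identityʳ; ∧-identityʳ; not-¬; ¬-not; ∨-∧-booleanAlgebra)
open import Data.List using (List; []; _∷_)
open import Data.List.Membership.Propositional using (_∈_; _∉_)
open import Data.List.Membership.Propositional.Properties using (∈-++⁺ˡ; ∈-++⁺ʳ)
open import Data.List.Relation.Binary.Subset.Propositional using () renaming (_⊆_ to _⊆ᴸ_)
open import Data.List.Relation.Unary.Any using (here)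
open import Data.Product using (∃; _×_; _,_; proj₁; proj₂)
open import Data.Vec using (Vec; []; _∷_)
open import Function using (_∘_; _⇔_; mk⇔; Equivalence)
open import Level using (0ℓ)
open import Relation.Binary.PropositionalEquality using (_≡_; _≢_; refl; sym; trans; cong; cong₂; cong-app; subst)
open import Relation.Nullary using (¬_; Dec; yes; no; does; ¬?; contradiction)
open import Relation.Nullary.Decidable using (dec-true; dec-false; does-≡; does-⇔; decidable-stable)
open import Defs

-- The translation ♯ is correct because ⟪ γ ⟫ ψ denotes the action of γ on the set denoted by ψ, for
-- every formula ψ, open or not; so the body of a fixpoint, applied to its fresh variable, is an instance.
--
-- For ♭, the game G φ played for a winning set D denotes φ under every valuation for which each
-- variable Y occurring in φ denotes { ω | ω [ c ↦ κ Y ] ∈ D }: the play can only end in D by reaching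
-- a variable, whose name is then stored in c.  At a binder of X, fixpoints Z of the loop correspond
-- to c-invariant fixpoints of φ by Z ↦ { ω | ω [ c ↦ κ X ] ∈ Z }, since Z is determined by D
-- at states where c ≠ κ X.  The least and the greatest fixpoint of φ are c-invariant.

-- Boolean-valued subsets.

does⁻ : {P : Set} (P? : Dec P) → does P? ≡ true → P
does⁻ (yes p) _ = p

module Sets {A : Set} where

  ⊆-refl : {D : 𝒫 A} → D ⊆ˢ D
  ⊆-refl x x∈D = x∈D

  ⊆-trans : {D E F : 𝒫 A} → D ⊆ˢ E → E ⊆ˢ F → D ⊆ˢ F
  ⊆-trans D⊆E E⊆F x = E⊆F x ∘ D⊆E x

  ≡⇒⊆ : {D E : 𝒫 A} → D ≡ E → D ⊆ˢ E
  ≡⇒⊆ refl x x∈D = x∈D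

  ≡⇒⊇ : {D E : 𝒫 A} → D ≡ E → E ⊆ˢ D
  ≡⇒⊇ refl x x∈D = x∈D

  ∪-mono : {D D′ E E′ : 𝒫 A} → D ⊆ˢ D′ → E ⊆ˢ E′ → D ∪ E ⊆ˢ D′ ∪ E′
  ∪-mono {D} {D′} {E} {E′} D⊆D′ E⊆E′ x x∈ with D x in Dx
  ... | true  = cong (_|| E′ x) (D⊆D′ x Dx)
  ... | false = trans (cong (D′ x ||_) (E⊆E′ x x∈)) (∨-zeroʳ (D′ x))

  ∩-mono : {D D′ E E′ : 𝒫 A} → D ⊆ˢ D′ → E ⊆ˢ E′ → D ∩ E ⊆ˢ D′ ∩ E′
  ∩-mono {D} D⊆D′ E⊆E′ x x∈ with D x in Dx
  ... | true = cong₂ _&&_ (D⊆D′ x Dx) (E⊆E′ x x∈)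

  ∈-∁⁺ : (D : 𝒫 A) (x : A) → ¬ (x ∈ˢ D) → x ∈ˢ ∁ D
  ∈-∁⁺ D x x∉D = sym (¬-not (x∉D ∘ sym))

  ∈-∁⁻ : (D : 𝒫 A) (x : A) → x ∈ˢ ∁ D → ¬ (x ∈ˢ D)
  ∈-∁⁻ D x x∈∁D x∈D = not-¬ (sym x∈D) (sym x∈∁D)

  ∁-anti : {D E : 𝒫 A} → D ⊆ˢ E → ∁ E ⊆ˢ ∁ D
  ∁-anti {D} {E} D⊆E x x∉E = ∈-∁⁺ D x (∈-∁⁻ E x x∉E ∘ D⊆E x)

  -- One round of a loop guarded by `K`: it is left with goal `D` outside `K` and continued with
  -- goal `E` inside.
  merge : 𝒫 A → 𝒫 A → 𝒫 A → 𝒫 A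
  merge K D E x = if K x then E x else D x

  merge-mono : ∀ K D {E E′ : 𝒫 A} → E ⊆ˢ E′ → merge K D E ⊆ˢ merge K D E′
  merge-mono K D E⊆E′ x x∈ with K x
  ... | true  = E⊆E′ x x∈
  ... | false = x∈

module Model (em : ExcludedMiddle 0ℓ) (funext : Extensionality 0ℓ 0ℓ)
             (𝒳 𝒱 : Set) (L : Signature) (𝔄 : Structure 𝒳 L) where

  open Signature L
  open Syntax 𝒳 𝒱 L
  open Structure 𝔄
  open Semantics em 𝒳 𝒱 L 𝔄
  open Sets

  -- Comprehension and fixpoints of operators on subsets.

  ⊆-antisym : ∀ {A : Set} {D E : 𝒫 A} → D ⊆ˢ E → E ⊆ˢ D → D ≡ E
  ⊆-antisym D⊆E E⊆D = funext λ x → ⇔→≡ {z = true} (mk⇔ (D⊆E x) (E⊆D x))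

  ∁-involutive : ∀ {A : Set} (D : 𝒫 A) → ∁ (∁ D) ≡ D
  ∁-involutive D = funext λ x → not-involutive (D x)

  em⁺ : {P : Set} → P → does (em {P}) ≡ true
  em⁺ = dec-true em

  em⁻ : {P : Set} → does (em {P}) ≡ true → P
  em⁻ = does⁻ em

  compr-mono : ∀ {A : Set} {P Q : A → Set} → (∀ x → P x → Q x) → compr P ⊆ˢ compr Q
  compr-mono P⇒Q x = em⁺ ∘ P⇒Q x ∘ em⁻

  compr-cong : ∀ {A : Set} {P Q : A → Set} → (∀ x → P x ⇔ Q x) → compr P ≡ compr Q
  compr-cong P⇔Q = funext λ x → does-⇔ (P⇔Q x) em em

  ∁-compr : ∀ {A : Set} (P : A → Set) → ∁ (compr P) ≡ compr (¬_ ∘ P)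
  ∁-compr P = funext λ x → does-≡ (¬? em) em

  ∁-compr-¬ : ∀ {A : Set} (P : A → Set) → ∁ (compr (¬_ ∘ P)) ≡ compr P
  ∁-compr-¬ P = trans (cong ∁ (sym (∁-compr P))) (∁-involutive (compr P))

  Monotone : ∀ {A : Set} → (𝒫 A → 𝒫 A) → Set
  Monotone F = ∀ {D E} → D ⊆ˢ E → F D ⊆ˢ F E

  lfp gfp : ∀ {A : Set} → (𝒫 A → 𝒫 A) → 𝒫 A
  lfp F = ⋂ λ D → F D ⊆ˢ D
  gfp F = ⋃ λ D → D ⊆ˢ F D

  module _ {A : Set} (F : 𝒫 A → 𝒫 A) where

    lfp-least : ∀ {D} → F D ⊆ˢ D → lfp F ⊆ˢ D
    lfp-least {D} FD⊆D x x∈ = em⁻ x∈ D FD⊆D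

    gfp-greatest : ∀ {D} → D ⊆ˢ F D → D ⊆ˢ gfp F
    gfp-greatest {D} D⊆FD x x∈D = em⁺ (D , D⊆FD , x∈D)

    module _ (mono : Monotone F) where

      -- Knaster-Tarski: `lfp F` lies below each prefixed point `D`, so by monotonicity `F (lfp F)`
      -- lies below `F D` and hence below `D`.
      lfp-prefixed : F (lfp F) ⊆ˢ lfp F
      lfp-prefixed x x∈ = em⁺ λ D FD⊆D → FD⊆D x (mono (lfp-least FD⊆D) x x∈)

      lfp-fixed : lfp F ≡ F (lfp F)
      lfp-fixed = ⊆-antisym (lfp-least (mono lfp-prefixed)) lfp-prefixed

      gfp-postfixed : gfp F ⊆ˢ F (gfp F)
      gfp-postfixed x x∈ with em⁻ x∈
      ... | D , D⊆FD , x∈D = mono (gfp-greatest D⊆FD) x (D⊆FD x x∈D)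

      gfp-fixed : gfp F ≡ F (gfp F)
      gfp-fixed = ⊆-antisym gfp-postfixed (gfp-greatest (mono gfp-postfixed))

  lfp-mono : ∀ {A : Set} {F H : 𝒫 A → 𝒫 A} → (∀ D → F D ⊆ˢ H D) → lfp F ⊆ˢ lfp H
  lfp-mono F⊆H = compr-mono λ x x∈ D HD⊆D → x∈ D (⊆-trans (F⊆H D) HD⊆D)

  gfp-mono : ∀ {A : Set} {F H : 𝒫 A → 𝒫 A} → (∀ D → F D ⊆ˢ H D) → gfp F ⊆ˢ gfp H
  gfp-mono F⊆H = compr-mono λ { x (D , D⊆FD , x∈D) → D , ⊆-trans D⊆FD (F⊆H D) , x∈D }

  -- Complementation exchanges the prefixed points of `F` with the postfixed points of its dual `H`.
  ∁-lfp : ∀ {A : Set} (F : 𝒫 A → 𝒫 A) → ∁ (lfp F) ≡ gfp λ D → ∁ (F (∁ D))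
  ∁-lfp F = ⊆-antisym
    (subst (λ E → ∁ (lfp F) ⊆ˢ E) (∁-involutive (gfp H))
      (∁-anti {D = ∁ (gfp H)} λ x x∉gfp → em⁺ λ D FD⊆D → decidable-stable em λ x∉D →
        ∈-∁⁻ (gfp H) x x∉gfp (gfp-greatest H
          (subst (λ E → ∁ D ⊆ˢ ∁ (F E)) (sym (∁-involutive D)) (∁-anti FD⊆D)) x (∈-∁⁺ D x x∉D))))
    λ x x∈ → let D , D⊆ , x∈D = em⁻ x∈ in
      ∁-anti (lfp-least F {∁ D} (⊆-trans (≡⇒⊇ (∁-involutive _)) (∁-anti D⊆))) x
        (trans (not-involutive (D x)) x∈D)
    where
    H = λ D → ∁ (F (∁ D))

  -- `F` is the dual of its own dual, so this is `∁-lfp` for the dual, complemented.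
  ∁-gfp : ∀ {A : Set} (F : 𝒫 A → 𝒫 A) → ∁ (gfp F) ≡ lfp λ D → ∁ (F (∁ D))
  ∁-gfp F = trans (cong (∁ ∘ gfp) (funext λ D → sym (trans (∁-involutive _) (cong F (∁-involutive D)))))
                  (trans (cong ∁ (sym (∁-lfp λ D → ∁ (F (∁ D))))) (∁-involutive _))

  -- Updates of states and valuations.

  module _ {A B : Set} where

    update-at : (f : A → B) (x : A) (b : B) → update f x b x ≡ b
    update-at f x b = cong (if_then b else f x) (dec-true em refl)

    update-off : (f : A → B) {x y : A} (b : B) → y ≢ x → update f x b y ≡ f y
    update-off f {x} {y} b y≢x = cong (if_then b else f y) (dec-false em y≢x)

    update-update : (f : A → B) (x : A) (b b′ : B) → update (update f x b) x b′ ≡ update f x b′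
    update-update f x b b′ = funext λ y → by-cases y (em {y ≡ x})
      where
      by-cases : ∀ y → Dec (y ≡ x) → update (update f x b) x b′ y ≡ update f x b′ y
      by-cases y (yes refl) = trans (update-at (update f y b) y b′) (sym (update-at f y b′))
      by-cases y (no y≢x)   =
        trans (update-off (update f x b) b′ y≢x) (trans (update-off f b y≢x) (sym (update-off f b′ y≢x)))

    update-self : (f : A → B) (x : A) → update f x (f x) ≡ f
    update-self f x = funext λ y → by-cases y (em {y ≡ x})
      where
      by-cases : ∀ y → Dec (y ≡ x) → update f x (f x) y ≡ f y
      by-cases y (yes refl) = update-at f y (f y)
      by-cases y (no y≢x)   = update-off f (f x) y≢x

  lookup-at : ∀ Ω X D → (Ω [ X ↦ D ]ᵛ) ⟨ X ⟩± ≡ D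
  lookup-at Ω (pos X) D = update-at Ω X D
  lookup-at Ω (neg X) D = trans (cong ∁ (update-at Ω X (∁ D))) (∁-involutive D)

  lookup-off : ∀ Ω X Y D → Y ≢ X → Y ≢ X ⁻ → (Ω [ X ↦ D ]ᵛ) ⟨ Y ⟩± ≡ Ω ⟨ Y ⟩±
  lookup-off Ω (pos X) (pos Y) D Y≢X Y≢X⁻ = update-off Ω D (Y≢X ∘ cong pos)
  lookup-off Ω (neg X) (pos Y) D Y≢X Y≢X⁻ = update-off Ω (∁ D) (Y≢X⁻ ∘ cong pos)
  lookup-off Ω (pos X) (neg Y) D Y≢X Y≢X⁻ = cong ∁ (update-off Ω D (Y≢X⁻ ∘ cong neg))
  lookup-off Ω (neg X) (neg Y) D Y≢X Y≢X⁻ = cong ∁ (update-off Ω (∁ D) (Y≢X ∘ cong neg))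

  update-⁻ : ∀ Ω X D → Ω [ X ⁻ ↦ D ]ᵛ ≡ Ω [ X ↦ ∁ D ]ᵛ
  update-⁻ Ω (pos X) D = refl
  update-⁻ Ω (neg X) D = cong (update Ω X) (sym (∁-involutive D))

  -- The negative form passes to subformulas by composition with the projections out of `_∌_`.
  infix 4 _occursIn_
  _occursIn_ : 𝒱± → Lμ → Set
  Y occursIn φ = ¬ (φ ∌ Y)

  lookup-occurring : ∀ Ω {X Y} φ D → φ ∌ X ⁻ → Y ≢ X → Y occursIn φ → (Ω [ X ↦ D ]ᵛ) ⟨ Y ⟩± ≡ Ω ⟨ Y ⟩±
  lookup-occurring Ω {X} {Y} φ D h Y≢X occ = lookup-off Ω X Y D Y≢X λ { refl → occ h }

  -- The common step at a binder. An update at `X` also changes `X ⁻`, but `X ⁻` does not occur in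
  -- the body, so only `Y ≡ X` and untouched variables remain.
  bind : (P : 𝒱± → 𝒫 State → Set) → ∀ Ω X φ → φ ∌ X ⁻ → ∀ {D} → P X D →
         (∀ Y → Y ≢ X → Y occursIn φ → P Y (Ω ⟨ Y ⟩±)) →
         ∀ Y → Y occursIn φ → P Y ((Ω [ X ↦ D ]ᵛ) ⟨ Y ⟩±)
  bind P Ω X φ h {D} PX PΩ Y occ with em {Y ≡ X}
  ... | yes refl = subst (P Y) (sym (lookup-at Ω X D)) PX
  ... | no Y≢X   = subst (P Y) (sym (lookup-occurring Ω φ D h Y≢X occ)) (PΩ Y Y≢X occ)

  -- Monotonicity and coincidence for the μ-calculus.

  ⟨⟩-mono : ∀ a → Monotone ⟦⟨ a ⟩⟧
  ⟨⟩-mono a D⊆E = compr-mono λ { ω (ω′ , step , ω′∈D) → ω′ , step , D⊆E ω′ ω′∈D }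

  []-mono : ∀ a → Monotone ⟦[ a ]⟧
  []-mono a D⊆E = compr-mono λ ω box ω′ step → D⊆E ω′ (box ω′ step)

  -- In body-mono and its analogues below, the assumption ¬ (Y ≢ X → φ ∌ Y) is Y occursIn μ X φ h
  -- and also Y occursIn ν X φ h, unfolded.
  ⟦⟧μ-mono : ∀ φ {Ω Ω′} → (∀ Y → Y occursIn φ → Ω ⟨ Y ⟩± ⊆ˢ Ω′ ⟨ Y ⟩±) → Ω ⟦ φ ⟧μ ⊆ˢ Ω′ ⟦ φ ⟧μ
  body-mono : ∀ φ {X Ω Ω′} → φ ∌ X ⁻ → (∀ Y → ¬ (Y ≢ X → φ ∌ Y) → Ω ⟨ Y ⟩± ⊆ˢ Ω′ ⟨ Y ⟩±) →
              ∀ {D D′} → D ⊆ˢ D′ → (Ω [ X ↦ D ]ᵛ) ⟦ φ ⟧μ ⊆ˢ (Ω′ [ X ↦ D′ ]ᵛ) ⟦ φ ⟧μ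

  ⟦⟧μ-mono (lit p)   Ω⊆Ω′ = ⊆-refl
  ⟦⟧μ-mono (var X)   Ω⊆Ω′ = Ω⊆Ω′ X (λ X≢X → X≢X refl)
  ⟦⟧μ-mono (φ₁ ∨ φ₂) Ω⊆Ω′ = ∪-mono (⟦⟧μ-mono φ₁ λ Y occ → Ω⊆Ω′ Y (occ ∘ proj₁))
                                   (⟦⟧μ-mono φ₂ λ Y occ → Ω⊆Ω′ Y (occ ∘ proj₂))
  ⟦⟧μ-mono (φ₁ ∧ φ₂) Ω⊆Ω′ = ∩-mono (⟦⟧μ-mono φ₁ λ Y occ → Ω⊆Ω′ Y (occ ∘ proj₁))
                                   (⟦⟧μ-mono φ₂ λ Y occ → Ω⊆Ω′ Y (occ ∘ proj₂))
  ⟦⟧μ-mono (⟨ a ⟩ φ) Ω⊆Ω′ = ⟨⟩-mono a (⟦⟧μ-mono φ Ω⊆Ω′)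
  ⟦⟧μ-mono ([ a ] φ) Ω⊆Ω′ = []-mono a (⟦⟧μ-mono φ Ω⊆Ω′)
  ⟦⟧μ-mono (μ X φ h) Ω⊆Ω′ = lfp-mono λ D → body-mono φ h Ω⊆Ω′ ⊆-refl
  ⟦⟧μ-mono (ν X φ h) Ω⊆Ω′ = gfp-mono λ D → body-mono φ h Ω⊆Ω′ ⊆-refl

  body-mono φ {X} {Ω} {Ω′} h Ω⊆Ω′ {D} {D′} D⊆D′ =
    ⟦⟧μ-mono φ (bind (λ Y E → E ⊆ˢ (Ω′ [ X ↦ D′ ]ᵛ) ⟨ Y ⟩±) Ω X φ h
      (⊆-trans D⊆D′ (≡⇒⊇ (lookup-at Ω′ X D′)))
      λ Y Y≢X occ → ⊆-trans (Ω⊆Ω′ Y λ k → occ (k Y≢X))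
                            (≡⇒⊇ (lookup-occurring Ω′ φ D′ h Y≢X occ)))

  -- Monotonicity, applied to the two inclusions in each value.
  ⟦⟧μ-coincidence : ∀ φ {Ω Ω′} → (∀ Y → Y occursIn φ → Ω ⟨ Y ⟩± ≡ Ω′ ⟨ Y ⟩±) → Ω ⟦ φ ⟧μ ≡ Ω′ ⟦ φ ⟧μ
  ⟦⟧μ-coincidence φ Ω≡Ω′ = ⊆-antisym (⟦⟧μ-mono φ λ Y → ≡⇒⊆ ∘ Ω≡Ω′ Y) (⟦⟧μ-mono φ λ Y → ≡⇒⊇ ∘ Ω≡Ω′ Y)

  -- Syntactic negation denotes complement.

  ∁-⟨⟩ : ∀ a D → ∁ (⟦⟨ a ⟩⟧ D) ≡ ⟦[ a ]⟧ (∁ D)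
  ∁-⟨⟩ a D = trans (∁-compr _) (compr-cong λ ω → mk⇔
    (λ ¬dia ω′ step → ∈-∁⁺ D ω′ λ ω′∈D → ¬dia (ω′ , step , ω′∈D))
    λ box (ω′ , step , ω′∈D) → ∈-∁⁻ D ω′ (box ω′ step) ω′∈D)

  ∁-[] : ∀ a D → ∁ (⟦[ a ]⟧ D) ≡ ⟦⟨ a ⟩⟧ (∁ D)
  ∁-[] a D = trans (cong (∁ ∘ ⟦[ a ]⟧) (sym (∁-involutive D)))
                   (trans (cong ∁ (sym (∁-⟨⟩ a (∁ D)))) (∁-involutive _))

  -- At a fixpoint, giving `X ⁻` the value `D` is giving `X` the value `∁ D`; the body of the
  -- negated formula is thus the dual operator in `∁-lfp` and `∁-gfp`.
  ⟦∼⟧ : ∀ φ Ω → Ω ⟦ ∼ φ ⟧μ ≡ ∁ (Ω ⟦ φ ⟧μ)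
  ∼-body : ∀ φ X D Ω → (Ω [ X ⁻ ↦ D ]ᵛ) ⟦ ∼ φ ⟧μ ≡ ∁ ((Ω [ X ↦ ∁ D ]ᵛ) ⟦ φ ⟧μ)

  ⟦∼⟧ (lit (+ˡ α))  Ω = sym (∁-compr _)
  ⟦∼⟧ (lit (-ˡ α))  Ω = sym (∁-compr-¬ _)
  ⟦∼⟧ (var (pos X)) Ω = refl
  ⟦∼⟧ (var (neg X)) Ω = sym (∁-involutive (Ω X))
  ⟦∼⟧ (φ₁ ∨ φ₂)     Ω =
    trans (cong₂ _∩_ (⟦∼⟧ φ₁ Ω) (⟦∼⟧ φ₂ Ω))
          (funext λ ω → sym (deMorgan₂ ∨-∧-booleanAlgebra ((Ω ⟦ φ₁ ⟧μ) ω) _))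
  ⟦∼⟧ (φ₁ ∧ φ₂)     Ω =
    trans (cong₂ _∪_ (⟦∼⟧ φ₁ Ω) (⟦∼⟧ φ₂ Ω))
          (funext λ ω → sym (deMorgan₁ ∨-∧-booleanAlgebra ((Ω ⟦ φ₁ ⟧μ) ω) _))
  ⟦∼⟧ (⟨ a ⟩ φ)     Ω = trans (cong ⟦[ a ]⟧ (⟦∼⟧ φ Ω)) (sym (∁-⟨⟩ a _))
  ⟦∼⟧ ([ a ] φ)     Ω = trans (cong ⟦⟨ a ⟩⟧ (⟦∼⟧ φ Ω)) (sym (∁-[] a _))
  ⟦∼⟧ (μ X φ _)     Ω = trans (cong gfp (funext λ D → ∼-body φ X D Ω)) (sym (∁-lfp _))
  ⟦∼⟧ (ν X φ _)     Ω = trans (cong lfp (funext λ D → ∼-body φ X D Ω)) (sym (∁-gfp _))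

  ∼-body φ X D Ω = trans (⟦∼⟧ φ (Ω [ X ⁻ ↦ D ]ᵛ)) (cong (λ Ω′ → ∁ (Ω′ ⟦ φ ⟧μ)) (update-⁻ Ω X D))

  -- Coincidence for game logic.

  ⟦⟧GL-coincidence : ∀ φ {Ω Ω′} → (∀ Y → Y ∈ propVars φ → Ω Y ≡ Ω′ Y) → Ω ⟦ φ ⟧GL ≡ Ω′ ⟦ φ ⟧GL
  ⟦⟧ᴳ-coincidence  : ∀ γ {Ω Ω′} → (∀ Y → Y ∈ propVarsᴳ γ → Ω Y ≡ Ω′ Y) → Ω ⟦ γ ⟧ᴳ ≡ Ω′ ⟦ γ ⟧ᴳ

  ⟦⟧GL-coincidence (lit p)   Ω≡Ω′ = refl
  ⟦⟧GL-coincidence (var X)   Ω≡Ω′ = Ω≡Ω′ X (here refl)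
  ⟦⟧GL-coincidence (¬ᴳ φ)    Ω≡Ω′ = cong ∁ (⟦⟧GL-coincidence φ Ω≡Ω′)
  ⟦⟧GL-coincidence (φ₁ ∨ φ₂) Ω≡Ω′ =
    cong₂ _∪_ (⟦⟧GL-coincidence φ₁ λ Y → Ω≡Ω′ Y ∘ ∈-++⁺ˡ)
              (⟦⟧GL-coincidence φ₂ λ Y → Ω≡Ω′ Y ∘ ∈-++⁺ʳ (propVars φ₁))
  ⟦⟧GL-coincidence (⟨ γ ⟩ φ) Ω≡Ω′ =
    cong₂ (λ F D → F D) (⟦⟧ᴳ-coincidence γ λ Y → Ω≡Ω′ Y ∘ ∈-++⁺ˡ)
                        (⟦⟧GL-coincidence φ λ Y → Ω≡Ω′ Y ∘ ∈-++⁺ʳ (propVarsᴳ γ))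

  ⟦⟧ᴳ-coincidence (act a)    Ω≡Ω′ = refl
  ⟦⟧ᴳ-coincidence (？ φ)      Ω≡Ω′ = cong _∩_ (⟦⟧GL-coincidence φ Ω≡Ω′)
  ⟦⟧ᴳ-coincidence (γ₁ ∪ᴳ γ₂) Ω≡Ω′ =
    cong₂ (λ F H D → F D ∪ H D) (⟦⟧ᴳ-coincidence γ₁ λ Y → Ω≡Ω′ Y ∘ ∈-++⁺ˡ)
                                (⟦⟧ᴳ-coincidence γ₂ λ Y → Ω≡Ω′ Y ∘ ∈-++⁺ʳ (propVarsᴳ γ₁))
  ⟦⟧ᴳ-coincidence (γ₁ ⨾ γ₂)  Ω≡Ω′ =
    cong₂ (λ F H D → F (H D)) (⟦⟧ᴳ-coincidence γ₁ λ Y → Ω≡Ω′ Y ∘ ∈-++⁺ˡ)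
                              (⟦⟧ᴳ-coincidence γ₂ λ Y → Ω≡Ω′ Y ∘ ∈-++⁺ʳ (propVarsᴳ γ₁))
  ⟦⟧ᴳ-coincidence (γ *)      Ω≡Ω′ = cong (λ F D → lfp λ Z → D ∪ F Z) (⟦⟧ᴳ-coincidence γ Ω≡Ω′)
  ⟦⟧ᴳ-coincidence (γ ᵈ)      Ω≡Ω′ = cong (λ F D → ∁ (F (∁ D))) (⟦⟧ᴳ-coincidence γ Ω≡Ω′)

  -- Correctness of `♯`.

  module SharpCorrect (inf𝒱 : Infinite 𝒱) where

    open Sharp 𝒳 𝒱 L inf𝒱

    ♯-correct  : ∀ φ Ω → Ω ⟦ φ ⟧GL ≡ Ω ⟦ φ ♯ ⟧μ
    ⟪⟫-correct : ∀ γ ψ Ω → (Ω ⟦ γ ⟧ᴳ) (Ω ⟦ ψ ⟧μ) ≡ Ω ⟦ ⟪ γ ⟫ ψ ⟧μ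

    ♯-correct (lit p)   Ω = refl
    ♯-correct (var X)   Ω = refl
    ♯-correct (¬ᴳ φ)    Ω = trans (cong ∁ (♯-correct φ Ω)) (sym (⟦∼⟧ (φ ♯) Ω))
    ♯-correct (φ₁ ∨ φ₂) Ω = cong₂ _∪_ (♯-correct φ₁ Ω) (♯-correct φ₂ Ω)
    ♯-correct (⟨ γ ⟩ φ) Ω = trans (cong (Ω ⟦ γ ⟧ᴳ) (♯-correct φ Ω)) (⟪⟫-correct γ (φ ♯) Ω)

    ⟪⟫-correct (act a)    ψ Ω = refl
    ⟪⟫-correct (？ φ)      ψ Ω = cong (_∩ (Ω ⟦ ψ ⟧μ)) (♯-correct φ Ω)
    ⟪⟫-correct (γ₁ ∪ᴳ γ₂) ψ Ω = cong₂ _∪_ (⟪⟫-correct γ₁ ψ Ω) (⟪⟫-correct γ₂ ψ Ω)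
    ⟪⟫-correct (γ₁ ⨾ γ₂)  ψ Ω =
      trans (cong (Ω ⟦ γ₁ ⟧ᴳ) (⟪⟫-correct γ₂ ψ Ω)) (⟪⟫-correct γ₁ (⟪ γ₂ ⟫ ψ) Ω)
    ⟪⟫-correct (γ *)      ψ Ω = cong lfp (funext λ D → cong₂ _∪_ (ψ-part D) (γ-part D))
      where
      X : 𝒱
      X = fresh γ ψ
      ψ-part : ∀ D → Ω ⟦ ψ ⟧μ ≡ (Ω [ pos X ↦ D ]ᵛ) ⟦ ψ ⟧μ
      ψ-part D = ⟦⟧μ-coincidence ψ λ Y occ → sym (lookup-off Ω (pos X) Y D
        (λ { refl → occ (allVars-∌ ψ Y (fresh∉ γ ψ ∘ ∈-++⁺ʳ (propVarsᴳ γ))) })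
        (λ { refl → occ (allVars-∌ ψ Y (fresh∉ γ ψ ∘ ∈-++⁺ʳ (propVarsᴳ γ))) }))
      γ-part : ∀ D → (Ω ⟦ γ ⟧ᴳ) D ≡ (Ω [ pos X ↦ D ]ᵛ) ⟦ ⟪ γ ⟫ var (pos X) ⟧μ
      γ-part D =
        -- `γ` does not mention the fresh `X`, so it may be read under the updated valuation, where
        -- `var (pos X)` denotes `D`; the induction hypothesis then applies to that variable.
        trans (cong₂ (λ F E → F E)
                (⟦⟧ᴳ-coincidence γ λ Y Y∈γ → sym (update-off Ω D λ { refl → fresh∉ γ ψ (∈-++⁺ˡ Y∈γ) }))
                (sym (update-at Ω X D)))
              (⟪⟫-correct γ (var (pos X)) (Ω [ pos X ↦ D ]ᵛ))
    ⟪⟫-correct (γ ᵈ)      ψ Ω =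
      trans (cong (∁ ∘ (Ω ⟦ γ ⟧ᴳ)) (sym (⟦∼⟧ ψ Ω)))
            (trans (cong ∁ (⟪⟫-correct γ (∼ ψ) Ω)) (sym (⟦∼⟧ (⟪ γ ⟫ ∼ ψ) Ω)))

  -- Monotonicity of games and demonic choice.

  ⟦⟧ᴳ-mono : ∀ γ {Ω} → Monotone (Ω ⟦ γ ⟧ᴳ)
  ⟦⟧ᴳ-mono (act a)    D⊆E = ⟨⟩-mono a D⊆E
  ⟦⟧ᴳ-mono (？ φ)      D⊆E = ∩-mono ⊆-refl D⊆E
  ⟦⟧ᴳ-mono (γ₁ ∪ᴳ γ₂) D⊆E = ∪-mono (⟦⟧ᴳ-mono γ₁ D⊆E) (⟦⟧ᴳ-mono γ₂ D⊆E)
  ⟦⟧ᴳ-mono (γ₁ ⨾ γ₂)  D⊆E = ⟦⟧ᴳ-mono γ₁ (⟦⟧ᴳ-mono γ₂ D⊆E)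
  ⟦⟧ᴳ-mono (γ *)      D⊆E = lfp-mono λ Z → ∪-mono D⊆E ⊆-refl
  ⟦⟧ᴳ-mono (γ ᵈ)      D⊆E = ∁-anti (⟦⟧ᴳ-mono γ (∁-anti D⊆E))

  ⟦∩ᴳ⟧ : ∀ γ₁ γ₂ Ω D → (Ω ⟦ γ₁ ∩ᴳ γ₂ ⟧ᴳ) D ≡ (Ω ⟦ γ₁ ⟧ᴳ) D ∩ (Ω ⟦ γ₂ ⟧ᴳ) D
  ⟦∩ᴳ⟧ γ₁ γ₂ Ω D =
    trans (funext λ ω → deMorgan₂ ∨-∧-booleanAlgebra (E₁ ω) (E₂ ω))
          (cong₂ _∩_ (undual γ₁) (undual γ₂))
    where
    E₁ = (Ω ⟦ γ₁ ᵈ ⟧ᴳ) (∁ D)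
    E₂ = (Ω ⟦ γ₂ ᵈ ⟧ᴳ) (∁ D)
    undual : ∀ γ → ∁ ((Ω ⟦ γ ᵈ ⟧ᴳ) (∁ D)) ≡ (Ω ⟦ γ ⟧ᴳ) D
    undual γ = trans (∁-involutive _) (cong (Ω ⟦ γ ⟧ᴳ) (∁-involutive D))

  -- Renaming of bound propositional variables.

  ⟦⟧μ-α : ∀ {Γ φ ψ} → Γ ⊢ φ ≈α ψ → ∀ {Ω Ω′} →
          (∀ {X Y} → Γ ⊢ X ≈ᵛ Y → X occursIn φ → Y occursIn ψ → Ω ⟨ X ⟩± ≡ Ω′ ⟨ Y ⟩±) →
          Ω ⟦ φ ⟧μ ≡ Ω′ ⟦ ψ ⟧μ
  body-α : ∀ {Γ φ ψ X Y} → φ ∌ X ⁻ → ψ ∌ Y ⁻ → ((X , Y) ∷ Γ) ⊢ φ ≈α ψ → ∀ {Ω Ω′} →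
           (∀ {X′ Y′} → Γ ⊢ X′ ≈ᵛ Y′ → ¬ (X′ ≢ X → φ ∌ X′) → ¬ (Y′ ≢ Y → ψ ∌ Y′) →
              Ω ⟨ X′ ⟩± ≡ Ω′ ⟨ Y′ ⟩±) →
           ∀ D → (Ω [ X ↦ D ]ᵛ) ⟦ φ ⟧μ ≡ (Ω′ [ Y ↦ D ]ᵛ) ⟦ ψ ⟧μ

  ⟦⟧μ-α lit                 Ω≡Ω′ = refl
  ⟦⟧μ-α (var X≈Y)           Ω≡Ω′ = Ω≡Ω′ X≈Y (λ X≢X → X≢X refl) (λ Y≢Y → Y≢Y refl)
  ⟦⟧μ-α (or e₁ e₂)          Ω≡Ω′ = cong₂ _∪_ (⟦⟧μ-α e₁ λ v i j → Ω≡Ω′ v (i ∘ proj₁) (j ∘ proj₁))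
                                             (⟦⟧μ-α e₂ λ v i j → Ω≡Ω′ v (i ∘ proj₂) (j ∘ proj₂))
  ⟦⟧μ-α (and e₁ e₂)         Ω≡Ω′ = cong₂ _∩_ (⟦⟧μ-α e₁ λ v i j → Ω≡Ω′ v (i ∘ proj₁) (j ∘ proj₁))
                                             (⟦⟧μ-α e₂ λ v i j → Ω≡Ω′ v (i ∘ proj₂) (j ∘ proj₂))
  ⟦⟧μ-α (dia {a} e)         Ω≡Ω′ = cong ⟦⟨ a ⟩⟧ (⟦⟧μ-α e Ω≡Ω′)
  ⟦⟧μ-α (box {a} e)         Ω≡Ω′ = cong ⟦[ a ]⟧ (⟦⟧μ-α e Ω≡Ω′)
  ⟦⟧μ-α (mu {h = h} {k} e)  Ω≡Ω′ = cong lfp (funext (body-α h k e Ω≡Ω′))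
  ⟦⟧μ-α (nu {h = h} {k} e)  Ω≡Ω′ = cong gfp (funext (body-α h k e Ω≡Ω′))

  body-α {φ = φ} {ψ} {X} {Y} h k e {Ω} {Ω′} Ω≡Ω′ D = ⟦⟧μ-α e λ where
    bound i j → trans (lookup-at Ω X D) (sym (lookup-at Ω′ Y D))
    -- `skip` does not exclude that `X′` is `X ⁻`, whose value the update changes. The occurrence
    -- `i` excludes it by the side condition of the binder, and `j` does the same for `Y′`.
    (skip X′≢X Y′≢Y v) i j →
      trans (lookup-occurring Ω φ D h X′≢X i)
            (trans (Ω≡Ω′ v (λ f → i (f X′≢X)) (λ f → j (f Y′≢Y)))
                   (sym (lookup-occurring Ω′ ψ D k Y′≢Y j)))

  -- This carries closedness over to the renamed formula.
  ∌-α : ∀ {Γ φ ψ} → Γ ⊢ φ ≈α ψ → ∀ Y → (∀ {X} → Γ ⊢ X ≈ᵛ Y → φ ∌ X) → ψ ∌ Y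
  ∌-α lit         Y φ∌ = _
  ∌-α (var X≈Y)   Y φ∌ = λ { refl → φ∌ X≈Y refl }
  ∌-α (or e₁ e₂)  Y φ∌ = ∌-α e₁ Y (proj₁ ∘ φ∌) , ∌-α e₂ Y (proj₂ ∘ φ∌)
  ∌-α (and e₁ e₂) Y φ∌ = ∌-α e₁ Y (proj₁ ∘ φ∌) , ∌-α e₂ Y (proj₂ ∘ φ∌)
  ∌-α (dia e)     Y φ∌ = ∌-α e Y φ∌
  ∌-α (box e)     Y φ∌ = ∌-α e Y φ∌
  ∌-α (mu e)      Y φ∌ = λ Y≢Y′ → ∌-α e Y λ where
    bound           → contradiction refl Y≢Y′
    (skip X≢X′ _ v) → φ∌ v X≢X′
  ∌-α (nu e)      Y φ∌ = λ Y≢Y′ → ∌-α e Y λ where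
    bound           → contradiction refl Y≢Y′
    (skip X≢X′ _ v) → φ∌ v X≢X′

  -- Terms, literals and assignments.

  ⟦⟧ᵗ-coincidence  : ∀ t {ω ω′} → (∀ x → x ∈ objVarsᵗ t → ω x ≡ ω′ x) → ω ⟦ t ⟧ᵗ ≡ ω′ ⟦ t ⟧ᵗ
  ⟦⟧ᵗˢ-coincidence : ∀ {n} (ts : Vec Term n) {ω ω′} → (∀ x → x ∈ objVarsᵗˢ ts → ω x ≡ ω′ x) →
                     ω ⟦ ts ⟧ᵗˢ ≡ ω′ ⟦ ts ⟧ᵗˢ
  ⟦⟧ᵗ-coincidence (var x)    ω≡ω′ = ω≡ω′ x (here refl)
  ⟦⟧ᵗ-coincidence (fun f ts) ω≡ω′ = cong (⟦fun⟧ f) (⟦⟧ᵗˢ-coincidence ts ω≡ω′)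
  ⟦⟧ᵗˢ-coincidence []       ω≡ω′ = refl
  ⟦⟧ᵗˢ-coincidence (t ∷ ts) ω≡ω′ =
    cong₂ _∷_ (⟦⟧ᵗ-coincidence t λ x → ω≡ω′ x ∘ ∈-++⁺ˡ)
              (⟦⟧ᵗˢ-coincidence ts λ x → ω≡ω′ x ∘ ∈-++⁺ʳ (objVarsᵗ t))

  -- An equality of types, rather than an equivalence, can be carried through `compr` by congruence.
  ⊨-coincidence : ∀ p {ω ω′} → (∀ x → x ∈ objVars p → ω x ≡ ω′ x) → (ω ⊨ p) ≡ (ω′ ⊨ p)
  ⊨ᵃ-coincidence : ∀ α {ω ω′} → (∀ x → x ∈ objVarsᵃ α → ω x ≡ ω′ x) → (ω ⊨ᵃ α) ≡ (ω′ ⊨ᵃ α)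
  ⊨-coincidence (+ˡ α) ω≡ω′ = ⊨ᵃ-coincidence α ω≡ω′
  ⊨-coincidence (-ˡ α) ω≡ω′ = cong ¬_ (⊨ᵃ-coincidence α ω≡ω′)
  ⊨ᵃ-coincidence (s ≐ t)    ω≡ω′ =
    cong₂ _≡_ (⟦⟧ᵗ-coincidence s λ x → ω≡ω′ x ∘ ∈-++⁺ˡ)
              (⟦⟧ᵗ-coincidence t λ x → ω≡ω′ x ∘ ∈-++⁺ʳ (objVarsᵗ s))
  ⊨ᵃ-coincidence (rel r ts) ω≡ω′ = cong (_∈ˢ ⟦rel⟧ r) (⟦⟧ᵗˢ-coincidence ts ω≡ω′)

  -- An assignment has exactly one successor, so its diamond is a preimage.
  ⟦≔⟧-update : ∀ {det} → IsAssignmentStructure det → let open DeterministicAssignments det in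
               ∀ x θ D → ⟦⟨ x ≔ θ ⟩⟧ D ≡ λ ω → D (ω [ x ↦ ω ⟦ θ ⟧ᵗ ])
  ⟦≔⟧-update asg x θ D = ⊆-antisym
    (λ ω ω∈ → let ω′ , step , ω′∈D = em⁻ ω∈ in
      subst (_∈ˢ D) (Equivalence.to (⟦≔⟧ x θ ω ω′) step) ω′∈D)
    λ ω ω∈ → em⁺ (_ , Equivalence.from (⟦≔⟧ x θ ω _) refl , ω∈)
    where open IsAssignmentStructure asg

  -- In the application, r overwrites c by κ X, K is c = κ X, F is the body of a fixpoint formula,
  -- and H is the body of the loop that plays it, g being the game of that body.
  module FixpointTransport {A : Set} (K D : 𝒫 A) (r : A → A) (r∈K : ∀ x → r x ∈ˢ K)
    (F g : 𝒫 A → 𝒫 A) (F-mono : Monotone F) (g-mono : Monotone g)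
    (g≡F : ∀ Z → (∀ x → x ∈ˢ ∁ K → Z x ≡ D x) → g Z ≡ F (Z ∘ r))
    (F-inv : ∀ E → F (E ∘ r) ∘ r ≡ F (E ∘ r)) where

    H : 𝒫 A → 𝒫 A
    H Z = merge K D (g Z)

    merge-off : ∀ E x → x ∈ˢ ∁ K → merge K D E x ≡ D x
    merge-off E x x∉K with K x
    ... | false = refl

    merge-∘r : ∀ E → merge K D E ∘ r ≡ E ∘ r
    merge-∘r E = funext λ x → cong (if_then E (r x) else D (r x)) (r∈K x)

    H-mono : Monotone H
    H-mono = merge-mono K D ∘ g-mono

    -- A fixpoint of `H` agrees with `D` off `K`, so `g≡F` applies to it. A prefixed point would
    -- only contain `D` there, which is why fixpoints are transported.
    ∘r-fixed : ∀ {Z} → Z ≡ H Z → Z ∘ r ≡ F (Z ∘ r)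
    ∘r-fixed {Z} Z≡HZ =
      trans (cong (_∘ r) Z≡HZ)
      (trans (merge-∘r (g Z))
      (trans (cong (_∘ r) (g≡F Z λ x x∉K → trans (cong-app Z≡HZ x) (merge-off (g Z) x x∉K))) (F-inv Z)))

    -- The way back: filling in `D` off `K` does not affect the values on the range of `r`, which
    -- determine an `r`-invariant `E`.
    merge-fixed : ∀ {E} → E ≡ F E → E ∘ r ≡ E → merge K D E ≡ H (merge K D E)
    merge-fixed {E} E≡FE E-inv = cong (merge K D)
      (trans E≡FE (trans (cong F (sym (trans (merge-∘r E) E-inv)))
                         (sym (g≡F (merge K D E) (merge-off E)))))

    ∘r-mono : ∀ {Z Z′ : 𝒫 A} → Z ⊆ˢ Z′ → Z ∘ r ⊆ˢ Z′ ∘ r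
    ∘r-mono Z⊆Z′ x = Z⊆Z′ (r x)

    lfp-transport : lfp F ∘ r ≡ lfp F → lfp H ∘ r ≡ lfp F
    lfp-transport inv = ⊆-antisym
      (⊆-trans (∘r-mono (lfp-least H (≡⇒⊇ (merge-fixed (lfp-fixed F F-mono) inv))))
               (≡⇒⊆ (trans (merge-∘r (lfp F)) inv)))
      (lfp-least F (≡⇒⊇ (∘r-fixed (lfp-fixed H H-mono))))

    gfp-transport : gfp F ∘ r ≡ gfp F → gfp H ∘ r ≡ gfp F
    gfp-transport inv = ⊆-antisym
      (gfp-greatest F (≡⇒⊆ (∘r-fixed (gfp-fixed H H-mono))))
      (⊆-trans (≡⇒⊇ (trans (merge-∘r (gfp F)) inv))
               (∘r-mono (gfp-greatest H (≡⇒⊆ (merge-fixed (gfp-fixed F F-mono) inv)))))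

  -- The left side is one round of the loop for `μ`: exit test with goal `D`, or guard and body.
  merge-∪ : ∀ {A : Set} (K D E : 𝒫 A) → (∁ K ∩ D) ∪ (K ∩ E) ≡ merge K D E
  merge-∪ K D E = funext λ x → by-cases (K x)
    where
    by-cases : ∀ {d e} k → (not k && d) || (k && e) ≡ (if k then e else d)
    by-cases true  = refl
    by-cases false = ∨-identityʳ _

  -- The same round for `ν`, in the form produced by unfolding the duals.
  merge-∩ : ∀ {A : Set} (K D E : 𝒫 A) →
            ∁ (∁ (∁ (∁ K ∩ ∁ D)) ∪ ∁ (∁ (K ∩ ∁ E))) ≡ merge K D E
  merge-∩ K D E = funext λ x → by-cases (K x) (D x) (E x)
    where
    by-cases : ∀ k d e → not (not (not (not k && not d)) || not (not (k && not e))) ≡ (if k then e else d)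
    by-cases true  d     true  = refl
    by-cases true  d     false = refl
    by-cases false true  e     = refl
    by-cases false false e     = refl

  -- Correctness of `♭`.

  module FlatCorrect
    (det : DeterministicAssignments) (asg : IsAssignmentStructure det)
    (𝒳₀ : List 𝒳) (𝒱₀ : List 𝒱±) (Λ : List Act) (κ : 𝒱± → Fun 0) (c : 𝒳)
    (κ-distinct : ∀ X Y → X ∈ 𝒱₀ → Y ∈ 𝒱₀ → X ≢ Y → ⟦const⟧ (κ X) ≢ ⟦const⟧ (κ Y))
    (c∉𝒳₀ : c ∉ 𝒳₀) (independent : ∀ a → a ∈ Λ → Independent c a) where

    open DeterministicAssignments det
    open Flat 𝒳 𝒱 L det

    Over-∌ : ∀ φ Y → Over 𝒳₀ 𝒱₀ Λ φ → Y ∉ 𝒱₀ → φ ∌ Y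
    Over-∌ (lit p)   Y o         Y∉ = _
    Over-∌ (var X)   Y o         Y∉ = λ { refl → Y∉ o }
    Over-∌ (φ₁ ∨ φ₂) Y (o₁ , o₂) Y∉ = Over-∌ φ₁ Y o₁ Y∉ , Over-∌ φ₂ Y o₂ Y∉
    Over-∌ (φ₁ ∧ φ₂) Y (o₁ , o₂) Y∉ = Over-∌ φ₁ Y o₁ Y∉ , Over-∌ φ₂ Y o₂ Y∉
    Over-∌ (⟨ a ⟩ φ) Y (_ , o)   Y∉ = Over-∌ φ Y o Y∉
    Over-∌ ([ a ] φ) Y (_ , o)   Y∉ = Over-∌ φ Y o Y∉
    Over-∌ (μ X φ _) Y (_ , o)   Y∉ = λ _ → Over-∌ φ Y o Y∉
    Over-∌ (ν X φ _) Y (_ , o)   Y∉ = λ _ → Over-∌ φ Y o Y∉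

    occursIn⇒∈𝒱₀ : ∀ φ {Y} → Over 𝒳₀ 𝒱₀ Λ φ → Y occursIn φ → Y ∈ 𝒱₀
    occursIn⇒∈𝒱₀ φ {Y} o occ = decidable-stable em (occ ∘ Over-∌ φ Y o)

    -- Only one inclusion is required; `invariant⁻` obtains the other by writing the old value of
    -- `c` back.
    Invariant : 𝒫 State → Set
    Invariant D = ∀ b → D ⊆ˢ λ ω → D (ω [ c ↦ b ])

    reset : ∀ ω b → (ω [ c ↦ b ]) [ c ↦ ω c ] ≡ ω
    reset ω b = trans (update-update ω c b (ω c)) (update-self ω c)

    invariant⁻ : ∀ D → Invariant D → ∀ b → (λ ω → D (ω [ c ↦ b ])) ⊆ˢ D
    invariant⁻ D inv b ω ω∈ = subst (_∈ˢ D) (reset ω b) (inv (ω c) _ ω∈)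

    invariant-lit : ∀ p → objVars p ⊆ᴸ 𝒳₀ → Invariant (⟦lit⟧ p)
    invariant-lit p o b ω ω∈ = trans (cong (λ P → does (em {P}))
      (⊨-coincidence p λ x x∈p → update-off ω b λ { refl → c∉𝒳₀ (o x∈p) })) ω∈

    invariant-⟨⟩ : ∀ {a D} → a ∈ Λ → Invariant D → Invariant (⟦⟨ a ⟩⟧ D)
    invariant-⟨⟩ a∈Λ inv b ω ω∈ = let ω′ , step , ω′∈D = em⁻ ω∈ in
      em⁺ (ω′ [ c ↦ b ] , independent _ a∈Λ ω ω′ step b , inv b ω′ ω′∈D)

    invariant-[] : ∀ {a D} → a ∈ Λ → Invariant D → Invariant (⟦[ a ]⟧ D)
    invariant-[] {a} {D} a∈Λ inv b ω ω∈ = em⁺ λ ω′ step →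
      -- Independence turns a step from `ω [ c ↦ b ]` to `ω′` into one from `ω` to `ω′ [ c ↦ ω c ]`.
      invariant⁻ D inv (ω c) ω′ (em⁻ ω∈ (ω′ [ c ↦ ω c ])
        (subst (λ υ → (υ , ω′ [ c ↦ ω c ]) ∈ˢ ⟦act⟧ a) (reset ω b) (independent a a∈Λ _ ω′ step (ω c))))

    module _ (F : 𝒫 State → 𝒫 State) (mono : Monotone F)
             (F-inv : ∀ {D} → Invariant D → Invariant (F D)) where

      -- The largest invariant subset `E` of `lfp F` is itself a prefixed point, hence all of
      -- `lfp F`.
      invariant-lfp : Invariant (lfp F)
      invariant-lfp b ω ω∈ = em⁻ (lfp-least F FE⊆E ω ω∈) b
        where
        E : 𝒫 State
        E = compr λ ω → ∀ b → ω [ c ↦ b ] ∈ˢ lfp F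
        E⊆lfp : E ⊆ˢ lfp F
        E⊆lfp ω ω∈ = subst (_∈ˢ lfp F) (update-self ω c) (em⁻ ω∈ (ω c))
        E-inv : Invariant E
        E-inv b ω ω∈ = em⁺ λ b′ → subst (_∈ˢ lfp F) (sym (update-update ω c b b′)) (em⁻ ω∈ b′)
        FE⊆E : F E ⊆ˢ E
        FE⊆E ω ω∈ = em⁺ λ b → lfp-prefixed F mono _ (mono E⊆lfp _ (F-inv E-inv b ω ω∈))

      -- Dually, the least invariant superset `E` of `gfp F` is a postfixed point.
      invariant-gfp : Invariant (gfp F)
      invariant-gfp b ω ω∈ = gfp-greatest F E⊆FE _ (em⁺ (ω c , subst (_∈ˢ gfp F) (sym (reset ω b)) ω∈))
        where
        E : 𝒫 State
        E = compr λ ω → ∃ λ b → ω [ c ↦ b ] ∈ˢ gfp F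
        gfp⊆E : gfp F ⊆ˢ E
        gfp⊆E ω ω∈ = em⁺ (ω c , subst (_∈ˢ gfp F) (sym (update-self ω c)) ω∈)
        E-inv : Invariant E
        E-inv b ω ω∈ = let b′ , ω′∈ = em⁻ ω∈ in
          em⁺ (b′ , subst (_∈ˢ gfp F) (sym (update-update ω c b b′)) ω′∈)
        E⊆FE : E ⊆ˢ F E
        E⊆FE ω ω∈ = let b , ω′∈ = em⁻ ω∈ in
          invariant⁻ (F E) (F-inv E-inv) b ω (mono gfp⊆E _ (gfp-postfixed F mono _ ω′∈))

    ⟦⟧μ-invariant : ∀ φ → Over 𝒳₀ 𝒱₀ Λ φ → ∀ {Ω} →
                    (∀ Y → Y occursIn φ → Invariant (Ω ⟨ Y ⟩±)) → Invariant (Ω ⟦ φ ⟧μ)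
    body-invariant : ∀ φ {X} → φ ∌ X ⁻ → Over 𝒳₀ 𝒱₀ Λ φ → ∀ {Ω} →
                     (∀ Y → ¬ (Y ≢ X → φ ∌ Y) → Invariant (Ω ⟨ Y ⟩±)) →
                     ∀ {D} → Invariant D → Invariant ((Ω [ X ↦ D ]ᵛ) ⟦ φ ⟧μ)

    ⟦⟧μ-invariant (lit p)   o         inv = invariant-lit p o
    ⟦⟧μ-invariant (var X)   o         inv = inv X (λ X≢X → X≢X refl)
    ⟦⟧μ-invariant (φ₁ ∨ φ₂) (o₁ , o₂) inv b =
      ∪-mono (⟦⟧μ-invariant φ₁ o₁ (λ Y occ → inv Y (occ ∘ proj₁)) b)
             (⟦⟧μ-invariant φ₂ o₂ (λ Y occ → inv Y (occ ∘ proj₂)) b)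
    ⟦⟧μ-invariant (φ₁ ∧ φ₂) (o₁ , o₂) inv b =
      ∩-mono (⟦⟧μ-invariant φ₁ o₁ (λ Y occ → inv Y (occ ∘ proj₁)) b)
             (⟦⟧μ-invariant φ₂ o₂ (λ Y occ → inv Y (occ ∘ proj₂)) b)
    ⟦⟧μ-invariant (⟨ a ⟩ φ) (a∈Λ , o) inv = invariant-⟨⟩ a∈Λ (⟦⟧μ-invariant φ o inv)
    ⟦⟧μ-invariant ([ a ] φ) (a∈Λ , o) inv = invariant-[] a∈Λ (⟦⟧μ-invariant φ o inv)
    ⟦⟧μ-invariant (μ X φ h) (_ , o)   inv =
      invariant-lfp _ (body-mono φ h λ Y occ → ⊆-refl) (body-invariant φ h o inv)
    ⟦⟧μ-invariant (ν X φ h) (_ , o)   inv =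
      invariant-gfp _ (body-mono φ h λ Y occ → ⊆-refl) (body-invariant φ h o inv)

    body-invariant φ {X} h o {Ω} inv D-inv =
      ⟦⟧μ-invariant φ o (bind (λ _ → Invariant) Ω X φ h D-inv λ Y Y≢X occ → inv Y λ k → occ (k Y≢X))

    -- Games of formulas and their loops.

    _at_ : State → 𝒱± → State
    ω at X = ω [ c ↦ ⟦const⟧ (κ X) ]

    is : 𝒱± → 𝒫 State
    is X = ⟦lit⟧ (+ˡ (var c ≐ const (κ X)))

    at∈is : ∀ X ω → ω at X ∈ˢ is X
    at∈is X ω = em⁺ (update-at ω c _)

    at∉is : ∀ X Y → X ∈ 𝒱₀ → Y ∈ 𝒱₀ → Y ≢ X → ∀ ω → ω at Y ∈ˢ ∁ (is X)
    at∉is X Y X∈ Y∈ Y≢X ω = cong not (dec-false em λ eq →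
      κ-distinct Y X Y∈ X∈ Y≢X (trans (sym (update-at ω c _)) eq))

    invariant-at : ∀ D X → Invariant (D ∘ (_at X))
    invariant-at D X b ω = subst (_∈ˢ D) (sym (update-update ω c b _))

    invariant⇒∘at : ∀ {D} X → Invariant D → D ∘ (_at X) ≡ D
    invariant⇒∘at {D} X inv = ⊆-antisym (invariant⁻ D inv _) (inv _)

    Matches : Valuation → 𝒫 State → 𝒱± → Set
    Matches Ω D Y = Ω ⟨ Y ⟩± ≡ D ∘ (_at Y)

    -- Shared by both fixpoint cases. The induction hypothesis `g-correct` ranges over all
    -- valuations and goals because inside the loop the goal is the candidate set `Z` in place of
    -- `D`.
    module Loop (Ω : Valuation) (D : 𝒫 State) {X : 𝒱±} (X∈𝒱₀ : X ∈ 𝒱₀)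
      (φ : Lμ) (h : φ ∌ X ⁻) (o : Over 𝒳₀ 𝒱₀ Λ φ)
      (match : ∀ Y → ¬ (Y ≢ X → φ ∌ Y) → Matches Ω D Y)
      (g : 𝒫 State → 𝒫 State) (g-mono : Monotone g)
      (g-correct : ∀ Ω D → (∀ Y → Y occursIn φ → Matches Ω D Y) → g D ≡ Ω ⟦ φ ⟧μ) where

      F : 𝒫 State → 𝒫 State
      F E = (Ω [ X ↦ E ]ᵛ) ⟦ φ ⟧μ

      F-mono : Monotone F
      F-mono = body-mono φ h λ Y occ → ⊆-refl

      F-inv : ∀ {E} → Invariant E → Invariant (F E)
      F-inv = body-invariant φ h o λ Y occ →
        subst Invariant (sym (match Y occ)) (invariant-at D Y)

      -- Reaching `X` leads to `Z` with the name of `X` in `c`. Any other occurring `Y` stores a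
      -- different name, hence ends outside `is X`, where `Z` agrees with `D`.
      g≡F : ∀ Z → (∀ ω → ω ∈ˢ ∁ (is X) → Z ω ≡ D ω) → g Z ≡ F (Z ∘ (_at X))
      g≡F Z Z≡D = g-correct _ Z (bind (λ Y E → E ≡ Z ∘ (_at Y)) Ω X φ h refl λ Y Y≢X occ →
        trans (match Y λ k → occ (k Y≢X))
              (funext λ ω → sym (Z≡D _ (at∉is X Y X∈𝒱₀ (occursIn⇒∈𝒱₀ φ o occ) Y≢X ω))))

      open FixpointTransport (is X) D (_at X) (at∈is X) F g F-mono g-mono g≡F
        (λ E → invariant⇒∘at X (F-inv (invariant-at E X)))

      lfp-loop : lfp (λ Z → merge (is X) D (g Z)) ∘ (_at X) ≡ lfp F
      lfp-loop = lfp-transport (invariant⇒∘at X (invariant-lfp F F-mono F-inv))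

      gfp-loop : gfp (λ Z → merge (is X) D (g Z)) ∘ (_at X) ≡ gfp F
      gfp-loop = gfp-transport (invariant⇒∘at X (invariant-gfp F F-mono F-inv))

    G-correct : ∀ Ω₀ φ → Over 𝒳₀ 𝒱₀ Λ φ → ∀ Ω D → (∀ Y → Y occursIn φ → Matches Ω D Y) →
                (Ω₀ ⟦ G κ c φ ⟧ᴳ) D ≡ Ω ⟦ φ ⟧μ
    -- The trailing `(？ ⊥ᴳ) ᵈ` is won from every state, so the goal `D` drops out and only the test
    -- of `p` counts.
    G-correct Ω₀ (lit p)   o Ω D match = funext λ ω →
      trans (cong (λ b → ⟦lit⟧ p ω && not (b && not (D ω))) (dec-false em λ 𝟎≢𝟎 → 𝟎≢𝟎 refl))
            (∧-identityʳ _)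
    G-correct Ω₀ (var X)   o Ω D match =
      trans (⟦≔⟧-update asg c (const (κ X)) D) (sym (match X λ X≢X → X≢X refl))
    G-correct Ω₀ (φ₁ ∨ φ₂) (o₁ , o₂) Ω D match =
      cong₂ _∪_ (G-correct Ω₀ φ₁ o₁ Ω D λ Y occ → match Y (occ ∘ proj₁))
                (G-correct Ω₀ φ₂ o₂ Ω D λ Y occ → match Y (occ ∘ proj₂))
    G-correct Ω₀ (φ₁ ∧ φ₂) (o₁ , o₂) Ω D match =
      trans (⟦∩ᴳ⟧ (G κ c φ₁) (G κ c φ₂) Ω₀ D)
            (cong₂ _∩_ (G-correct Ω₀ φ₁ o₁ Ω D λ Y occ → match Y (occ ∘ proj₁))
                       (G-correct Ω₀ φ₂ o₂ Ω D λ Y occ → match Y (occ ∘ proj₂)))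
    G-correct Ω₀ (⟨ a ⟩ φ) (_ , o) Ω D match = cong ⟦⟨ a ⟩⟧ (G-correct Ω₀ φ o Ω D match)
    G-correct Ω₀ ([ a ] φ) (_ , o) Ω D match =
      trans (∁-⟨⟩ a _) (cong ⟦[ a ]⟧ (trans (∁-involutive _) (G-correct Ω₀ φ o Ω D match)))
    G-correct Ω₀ (μ X φ h) (X∈𝒱₀ , o) Ω D match =
      trans (⟦≔⟧-update asg c (const (κ X)) _)
            -- The negated test denotes the complement of `is X`, which brings the loop body into
            -- `merge` form.
            (trans (cong (λ H → lfp H ∘ (_at X)) (funext λ Z →
                     trans (cong (λ E → (E ∩ D) ∪ (is X ∩ g Z)) (sym (∁-compr _)))
                           (merge-∪ (is X) D (g Z))))
                   lfp-loop)
      where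
      g = Ω₀ ⟦ G κ c φ ⟧ᴳ
      open Loop Ω D X∈𝒱₀ φ h o match g (⟦⟧ᴳ-mono (G κ c φ)) (G-correct Ω₀ φ o)
    G-correct Ω₀ (ν X φ h) (X∈𝒱₀ , o) Ω D match =
      trans (⟦≔⟧-update asg c (const (κ X)) _)
            -- The demonic loop is the complement of a least fixpoint, which `∁-lfp` turns into a
            -- greatest one.
            (trans (cong (_∘ (_at X)) (trans (∁-lfp _) (cong gfp (funext λ Z →
                     trans (cong₂ (λ E Z′ → ∁ (∁ (∁ (E ∩ ∁ D)) ∪ ∁ (∁ (is X ∩ ∁ (g Z′)))))
                                  (sym (∁-compr _)) (∁-involutive Z))
                           (merge-∩ (is X) D (g Z))))))
                   gfp-loop)
      where
      g = Ω₀ ⟦ G κ c φ ⟧ᴳ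
      open Loop Ω D X∈𝒱₀ φ h o match g (⟦⟧ᴳ-mono (G κ c φ)) (G-correct Ω₀ φ o)

    ♭-correct : ∀ {ψ ψ′} → IsLμ ψ → ψ ≈α ψ′ → Over 𝒳₀ 𝒱₀ Λ ψ′ → ∀ Ω → Ω ⟦ ψ ⟧μ ≡ Ω ⟦ _♭ κ c ψ′ ⟧GL
    ♭-correct {ψ} {ψ′} closed ψ≈ψ′ o Ω =
      trans (⟦⟧μ-α ψ≈ψ′ λ { free i j → refl })
            -- No variable occurs freely in `ψ′`, so the matching condition is vacuous and the goal
            -- may be the denotation of `⊤ᴳ`.
            (sym (G-correct Ω ψ′ o Ω _ λ Y occ → contradiction (∌-α ψ≈ψ′ Y λ {X} _ → closed X) occ))

corollary4p5 :
  (em : ExcludedMiddle 0ℓ) (funext : Extensionality 0ℓ 0ℓ)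
  (𝒳 𝒱 : Set) (inf𝒳 : Infinite 𝒳) (inf𝒱 : Infinite 𝒱)
  (L : Signature) (det : Syntax.DeterministicAssignments 𝒳 𝒱 L)
  (𝔄 : Structure 𝒳 L) (asg : Semantics.IsAssignmentStructure em 𝒳 𝒱 L 𝔄 det) →
  let open Signature L
      open Syntax 𝒳 𝒱 L
      open Sharp 𝒳 𝒱 L inf𝒱
      open Flat 𝒳 𝒱 L det
      open Structure 𝔄
      open Semantics em 𝒳 𝒱 L 𝔄
  in
  ((φ : GL) → IsGL φ → ∀ Ω → Ω ⟦ φ ⟧GL ≡ Ω ⟦ φ ♯ ⟧μ)
  ×
  ((𝒳₀ : List 𝒳) (𝒱₀ : List 𝒱±) (Λ : List Act)
   (κ : 𝒱± → Fun 0) (c : 𝒳) →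
   (∀ X Y → X ∈ 𝒱₀ → Y ∈ 𝒱₀ → X ≢ Y → ⟦const⟧ (κ X) ≢ ⟦const⟧ (κ Y)) →
   c ∉ 𝒳₀ →
   (∀ a → a ∈ Λ → Independent c a) →
   (ψ ψ′ : Lμ) → IsLμ ψ → ψ ≈α ψ′ → BoundAtMostOnce ψ′ → Over 𝒳₀ 𝒱₀ Λ ψ′ →
   ∀ Ω → Ω ⟦ ψ ⟧μ ≡ Ω ⟦ _♭ κ c ψ′ ⟧GL)
corollary4p5 em funext 𝒳 𝒱 inf𝒳 inf𝒱 L det 𝔄 asg =
  (λ φ closed → ♯-correct φ) ,
  λ 𝒳₀ 𝒱₀ Λ κ c κ-distinct c∉𝒳₀ independent ψ ψ′ closed ψ≈ψ′ unique →
    FlatCorrect.♭-correct det asg 𝒳₀ 𝒱₀ Λ κ c κ-distinct c∉𝒳₀ independent closed ψ≈ψ′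
  where
  open Model em funext 𝒳 𝒱 L 𝔄
  open SharpCorrect inf𝒱
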